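{- Let $n>2$ and $N\ge1$ be integers. The normaliser of $\Gamma_0(N)$ inside $\mathrm{GL}_n^+(\mathbb{Q})$, i.e. $\{g\in\mathrm{GL}_n^+(\mathbb{Q}) : g^{ -1}\Gamma_0(N)g=\Gamma_0(N)\}$, is equal to $\mathbb{Q}_{>0}\cdot\Gamma_0(N)$.
   Context: $\mathrm{GL}_n^+(\mathbb{Q})$ denotes the group of invertible rational $n\times n$ matrices with positive determinant. $\Gamma_0(N)\le\mathrm{SL}_n(\mathbb{Z})$ is the subgroup of integral matrices whose last row is congruent modulo $N$ to $(0,\dots,0,\ast)$. -}

module Defs where

open import Data.Nat as ℕ using (ℕ; zero; suc)
open import Data.Integer as ℤ using (ℤ; +_)
open import Data.Integer.Divisibility using () renaming (_∣_ to _∣ℤ_)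
open import Data.Rational as ℚ using (ℚ; 0ℚ; 1ℚ; _/_)
open import Data.Fin using (Fin; zero; suc; punchIn; fromℕ)
open import Data.Product using (Σ; _×_; ∃; _,_)
open import Relation.Binary.PropositionalEquality using (_≡_)
open import Relation.Nullary using (¬_)

Mat : Set → ℕ → Set
Mat A n = Fin n → Fin n → A

-- entrywise equality of matrices (no function extensionality in Agda)
infix 4 _≈ₘ_
infixl 7 _⊗_
_≈ₘ_ : ∀ {A n} → Mat A n → Mat A n → Set
A ≈ₘ B = ∀ i j → A i j ≡ B i j

Σℚ : (n : ℕ) → (Fin n → ℚ) → ℚ
Σℚ zero    f = 0ℚ
Σℚ (suc n) f = f zero ℚ.+ Σℚ n (λ i → f (suc i))

_⊗_ : ∀ {n} → Mat ℚ n → Mat ℚ n → Mat ℚ n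
_⊗_ {n} A B i j = Σℚ n (λ k → A i k ℚ.* B k j)

idMat : ∀ {n} → Mat ℚ n
idMat zero    zero    = 1ℚ
idMat zero    (suc j) = 0ℚ
idMat (suc i) zero    = 0ℚ
idMat (suc i) (suc j) = idMat i j

_·ₘ_ : ∀ {n} → ℚ → Mat ℚ n → Mat ℚ n
(q ·ₘ A) i j = q ℚ.* A i j

sgn : ∀ {n} → Fin n → ℚ
sgn zero    = 1ℚ
sgn (suc j) = ℚ.- sgn j

det : ∀ {n} → Mat ℚ n → ℚ
det {zero}  M = 1ℚ
det {suc n} M = Σℚ (suc n) (λ j → sgn j ℚ.* M zero j ℚ.* det {n} (λ i k → M (suc i) (punchIn j k)))

toℚMat : ∀ {n} → Mat ℤ n → Mat ℚ n
toℚMat γ i j = γ i j / 1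

InΓ₀ : (N : ℕ) {k : ℕ} → Mat ℤ (suc k) → Set
InΓ₀ N {k} γ = (det (toℚMat γ) ≡ 1ℚ)
             × (∀ (j : Fin (suc k)) → ¬ (j ≡ fromℕ k) → (+ N) ∣ℤ γ (fromℕ k) j)

_∈Γ₀_ : ∀ {k} → Mat ℚ (suc k) → ℕ → Set
g ∈Γ₀ N = ∃ λ γ → InΓ₀ N γ × (g ≈ₘ toℚMat γ)

IsInverse : ∀ {n} → Mat ℚ n → Mat ℚ n → Set
IsInverse g h = (h ⊗ g ≈ₘ idMat) × (g ⊗ h ≈ₘ idMat)

-- g normalises Γ₀(N): g⁻¹ Γ₀(N) g = Γ₀(N), where h = g⁻¹
Normalises : ∀ {k} → ℕ → (g h : Mat ℚ (suc k)) → Set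
Normalises N g h =
  (∀ γ → γ ∈Γ₀ N → ((h ⊗ γ) ⊗ g) ∈Γ₀ N)
  × (∀ δ → δ ∈Γ₀ N → ∃ λ γ → γ ∈Γ₀ N × (((h ⊗ γ) ⊗ g) ≈ₘ δ))

InScaledΓ₀ : ∀ {k} → ℕ → Mat ℚ (suc k) → Set
InScaledΓ₀ N g = ∃ λ q → (q ℚ.> 0ℚ) × ∃ λ γ → γ ∈Γ₀ N × (g ≈ₘ (q ·ₘ γ))

-- Let R be the order of integral matrices whose last row is ≡ (0, …, 0, *) mod N, and let h = g⁻¹.
-- Conjugation by g and by h preserves Γ₀(N) ⊆ R, so applying it to the transvections 1 + E i j (i not the
-- last index n) shows that the products h a i * g j b are integral unless i = n ≠ j, and, exchanging the
-- roles of g and h, unless b = n ≠ a.  The remaining products g j n * h a n are integral as well: modulo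
-- integers the top-left block of g h = 1 would otherwise exhibit an identity matrix of size ≥ 2 as a
-- matrix of rank one.  Hence if q is the gcd of the entries of g, both g / q and q h are integral, and
-- the conditions on the last row follow from those on the conjugated transvections.
--
-- Multiplicativity of det follows from its characterisation as the alternating multilinear form with
-- value 1 at the identity; integrality of inverses in Γ₀(N) is Cramer's rule.
module Submission where

open import Defs
open import Data.Nat as ℕ using (ℕ; zero; suc; _<_; _≤_)
import Data.Nat.Divisibility as ℕ
open import Data.Nat.GCD using (module GCD; module Bézout)
import Data.Nat.Properties as ℕ
open import Data.Integer as ℤ using (ℤ; +_; -[1+_]; ∣_∣)
import Data.Integer.Properties as ℤ
import Data.Integer.Divisibility as Unsigned
import Data.Integer.Divisibility.Signed as Signed
import Data.Integer.Solver
open import Data.Fin using (Fin; zero; suc; punchIn; fromℕ)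
open import Data.Fin.Properties using (_≟_; suc-injective; punchInᵢ≢i)
open import Data.Product using (_×_; _,_; ∃; proj₁; proj₂)
open import Data.Sum using (_⊎_; inj₁; inj₂)
open import Data.Rational as ℚ using (ℚ; 0ℚ; 1ℚ; _>_; _+_; _*_; -_; _/_; positive)
import Data.Rational.Unnormalised as ℚᵘ
import Data.Rational.Unnormalised.Properties as ℚᵘ
open import Data.Rational.Properties using
  (positive⁻¹; pos*pos⇒pos; +-identityˡ; +-identityʳ; *-identityˡ; *-identityʳ; *-zeroˡ; *-zeroʳ;
   *-assoc; *-comm; *-distribˡ-+; toℚᵘ-injective; toℚᵘ-fromℚᵘ; fromℚᵘ-injective; toℚᵘ-homo-+;
   toℚᵘ-homo-*; ↥p/↧p≡p; fromℚᵘ-cong; <-cmp; <-asym; neg-antimono-<)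
open import Data.Rational.Solver using (module +-*-Solver)
open import Data.Vec.Functional using (_∷_; tail; updateAt; insertAt)
open import Data.Vec.Functional.Properties using
  (updateAt-updates; updateAt-minimal; insertAt-lookup; insertAt-punchIn)
open import Function using (_∘_; const)
open import Relation.Binary.Definitions using (tri<; tri≈; tri>)
open import Relation.Binary.PropositionalEquality using
  (_≡_; _≢_; _≗_; refl; sym; trans; cong; cong₂; subst; module ≡-Reasoning)
open import Relation.Nullary using (yes; no; contradiction)

open +-*-Solver
open ≡-Reasoning

-- Finite sums

Σ-cong : ∀ {n} {f g : Fin n → ℚ} → f ≗ g → Σℚ n f ≡ Σℚ n g
Σ-cong {zero}  f≗g = refl
Σ-cong {suc n} f≗g = cong₂ _+_ (f≗g zero) (Σ-cong (f≗g ∘ suc))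

Σ-zero : ∀ {n} {f : Fin n → ℚ} → (∀ i → f i ≡ 0ℚ) → Σℚ n f ≡ 0ℚ
Σ-zero {zero}  f≗0 = refl
Σ-zero {suc n} f≗0 = trans (cong₂ _+_ (f≗0 zero) (Σ-zero (f≗0 ∘ suc))) (+-identityˡ 0ℚ)

Σ-linear : ∀ {n} s t (f g : Fin n → ℚ) →
           Σℚ n (λ i → s * f i + t * g i) ≡ s * Σℚ n f + t * Σℚ n g
Σ-linear {zero}  s t f g = solve 2 (λ s t → con 0ℚ := s :* con 0ℚ :+ t :* con 0ℚ) refl s t
Σ-linear {suc n} s t f g = begin
  (s * f zero + t * g zero) + Σℚ n (λ i → s * f (suc i) + t * g (suc i))
    ≡⟨ cong (λ x → s * f zero + t * g zero + x) (Σ-linear s t (f ∘ suc) (g ∘ suc)) ⟩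
  (s * f zero + t * g zero) + (s * Σℚ n (f ∘ suc) + t * Σℚ n (g ∘ suc))
    ≡⟨ solve 6 (λ s t a b c d → (s :* a :+ t :* b) :+ (s :* c :+ t :* d)
                             := s :* (a :+ c) :+ t :* (b :+ d))
         refl s t (f zero) (g zero) (Σℚ n (f ∘ suc)) (Σℚ n (g ∘ suc)) ⟩
  s * (f zero + Σℚ n (f ∘ suc)) + t * (g zero + Σℚ n (g ∘ suc)) ∎

Σ-distribˡ : ∀ {n} s (f : Fin n → ℚ) → s * Σℚ n f ≡ Σℚ n (λ i → s * f i)
Σ-distribˡ {zero}  s f = *-zeroʳ s
Σ-distribˡ {suc n} s f = trans
  (solve 3 (λ s a b → s :* (a :+ b) := s :* a :+ s :* b) refl s (f zero) (Σℚ n (f ∘ suc)))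
  (cong (λ x → s * f zero + x) (Σ-distribˡ s (f ∘ suc)))

Σ-distribʳ : ∀ {n} s (f : Fin n → ℚ) → Σℚ n f * s ≡ Σℚ n (λ i → f i * s)
Σ-distribʳ {zero}  s f = *-zeroˡ s
Σ-distribʳ {suc n} s f = trans
  (solve 3 (λ s a b → (a :+ b) :* s := a :* s :+ b :* s) refl s (f zero) (Σℚ n (f ∘ suc)))
  (cong (λ x → f zero * s + x) (Σ-distribʳ s (f ∘ suc)))

Σ-+ : ∀ {n} (f g : Fin n → ℚ) → Σℚ n (λ i → f i + g i) ≡ Σℚ n f + Σℚ n g
Σ-+ {n} f g = begin
  Σℚ n (λ i → f i + g i)
    ≡⟨ Σ-cong (λ i → sym (cong₂ _+_ (*-identityˡ (f i)) (*-identityˡ (g i)))) ⟩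
  Σℚ n (λ i → 1ℚ * f i + 1ℚ * g i)      ≡⟨ Σ-linear 1ℚ 1ℚ f g ⟩
  1ℚ * Σℚ n f + 1ℚ * Σℚ n g             ≡⟨ cong₂ _+_ (*-identityˡ (Σℚ n f)) (*-identityˡ (Σℚ n g)) ⟩
  Σℚ n f + Σℚ n g                       ∎

Σ-swap : ∀ {m n} (f : Fin m → Fin n → ℚ) →
         Σℚ m (λ i → Σℚ n (f i)) ≡ Σℚ n (λ j → Σℚ m (λ i → f i j))
Σ-swap {zero}  {n} f = sym (Σ-zero (λ (_ : Fin n) → refl))
Σ-swap {suc m} {n} f = trans
  (cong (λ x → Σℚ n (f zero) + x) (Σ-swap (f ∘ suc)))
  (sym (Σ-+ (f zero) (λ j → Σℚ m (λ i → f (suc i) j))))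

idMat-diag : ∀ {n} (i : Fin n) → idMat i i ≡ 1ℚ
idMat-diag zero    = refl
idMat-diag (suc i) = idMat-diag i

idMat-off : ∀ {n} {i j : Fin n} → i ≢ j → idMat i j ≡ 0ℚ
idMat-off {i = zero}  {zero}  i≢j = contradiction refl i≢j
idMat-off {i = zero}  {suc j} i≢j = refl
idMat-off {i = suc i} {zero}  i≢j = refl
idMat-off {i = suc i} {suc j} i≢j = idMat-off (i≢j ∘ cong suc)

Σ-idˡ : ∀ {n} i (f : Fin n → ℚ) → Σℚ n (λ l → idMat i l * f l) ≡ f i
Σ-idˡ {suc n} zero f = trans
  (cong₂ _+_ (*-identityˡ (f zero)) (Σ-zero {n} (λ l → *-zeroˡ (f (suc l)))))
  (+-identityʳ (f zero))
Σ-idˡ {suc n} (suc i) f = trans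
  (cong₂ _+_ (*-zeroˡ (f zero)) (Σ-idˡ i (f ∘ suc)))
  (+-identityˡ (f (suc i)))

Σ-idʳ : ∀ {n} j (f : Fin n → ℚ) → Σℚ n (λ l → f l * idMat l j) ≡ f j
Σ-idʳ {suc n} zero f = trans
  (cong₂ _+_ (*-identityʳ (f zero)) (Σ-zero {n} (λ l → *-zeroʳ (f (suc l)))))
  (+-identityʳ (f zero))
Σ-idʳ {suc n} (suc j) f = trans
  (cong₂ _+_ (*-zeroʳ (f zero)) (Σ-idʳ j (f ∘ suc)))
  (+-identityˡ (f (suc j)))

-- Matrix algebra

≈-sym : ∀ {n} {A B : Mat ℚ n} → A ≈ₘ B → B ≈ₘ A
≈-sym A≈B i j = sym (A≈B i j)

≈-trans : ∀ {n} {A B C : Mat ℚ n} → A ≈ₘ B → B ≈ₘ C → A ≈ₘ C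
≈-trans A≈B B≈C i j = trans (A≈B i j) (B≈C i j)

⊗-cong : ∀ {n} {A A′ B B′ : Mat ℚ n} → A ≈ₘ A′ → B ≈ₘ B′ → A ⊗ B ≈ₘ A′ ⊗ B′
⊗-cong A≈A′ B≈B′ i j = Σ-cong (λ l → cong₂ _*_ (A≈A′ i l) (B≈B′ l j))

⊗-assoc : ∀ {n} (A B C : Mat ℚ n) → (A ⊗ B) ⊗ C ≈ₘ A ⊗ (B ⊗ C)
⊗-assoc {n} A B C i j = begin
  Σℚ n (λ l → Σℚ n (λ k → A i k * B k l) * C l j)
    ≡⟨ Σ-cong (λ l → Σ-distribʳ (C l j) (λ k → A i k * B k l)) ⟩
  Σℚ n (λ l → Σℚ n (λ k → (A i k * B k l) * C l j))
    ≡⟨ Σ-swap (λ l k → (A i k * B k l) * C l j) ⟩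
  Σℚ n (λ k → Σℚ n (λ l → (A i k * B k l) * C l j))
    ≡⟨ Σ-cong (λ k → trans
         (Σ-cong (λ l → solve 3 (λ a b c → (a :* b) :* c := a :* (b :* c)) refl (A i k) (B k l) (C l j)))
         (sym (Σ-distribˡ (A i k) (λ l → B k l * C l j)))) ⟩
  Σℚ n (λ k → A i k * Σℚ n (λ l → B k l * C l j)) ∎

⊗-identityˡ : ∀ {n} (A : Mat ℚ n) → idMat ⊗ A ≈ₘ A
⊗-identityˡ A i j = Σ-idˡ i (λ l → A l j)

⊗-identityʳ : ∀ {n} (A : Mat ℚ n) → A ⊗ idMat ≈ₘ A
⊗-identityʳ A i j = Σ-idʳ j (A i)

-- Alternating multilinear forms

Rows : ℕ → ℕ → Set
Rows m n = Fin m → Fin n → ℚ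

infix 4 _≋_
_≋_ : ∀ {m n} → Rows m n → Rows m n → Set
A ≋ B = ∀ i → A i ≗ B i

-- `linear` relates three given matrices that agree off row `i`, instead of updating one matrix in
-- place. Any matrices with the right entries can then be used, and `congruent` makes up for the
-- absence of function extensionality.
record Multilinear {m n} (F : Rows m n → ℚ) : Set where
  field
    congruent : ∀ {A B} → A ≋ B → F A ≡ F B
    linear    : ∀ i s t {A B C} →
                (∀ l → l ≢ i → A l ≗ C l) → (∀ l → l ≢ i → B l ≗ C l) →
                (∀ j → C i j ≡ s * A i j + t * B i j) →
                F C ≡ s * F A + t * F B

  zero-row : ∀ i {C} → (∀ j → C i j ≡ 0ℚ) → F C ≡ 0ℚ
  zero-row i {C} Ci≡0 = begin
    -- With both coefficients 0, the matrix `C` itself can serve as all three arguments.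
    F C                   ≡⟨ linear i 0ℚ 0ℚ (λ _ _ _ → refl) (λ _ _ _ → refl) row ⟩
    0ℚ * F C + 0ℚ * F C   ≡⟨ solve 1 (λ x → con 0ℚ :* x :+ con 0ℚ :* x := con 0ℚ) refl (F C) ⟩
    0ℚ                    ∎
    where
    row : ∀ j → C i j ≡ 0ℚ * C i j + 0ℚ * C i j
    row j = trans (Ci≡0 j) (solve 1 (λ x → con 0ℚ := con 0ℚ :* x :+ con 0ℚ :* x) refl (C i j))

  -- Induction on the number of summands: linearity splits off the first one, and `C′` carries the
  -- remaining sum in row `i`. The empty sum is a zero row.
  expand : ∀ i {p} (s : Fin p → ℚ) (B : Fin p → Rows m n) {C} →
           (∀ k l → l ≢ i → B k l ≗ C l) →
           (∀ j → C i j ≡ Σℚ p (λ k → s k * B k i j)) →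
           F C ≡ Σℚ p (λ k → s k * F (B k))
  expand i {zero}  s B {C} agree row = zero-row i row
  expand i {suc p} s B {C} agree row = begin
    F C                             ≡⟨ linear i (s zero) 1ℚ (agree zero) (λ l → off l) split ⟩
    s zero * F (B zero) + 1ℚ * F C′ ≡⟨ cong (λ x → s zero * F (B zero) + x) (trans (*-identityˡ (F C′)) rest) ⟩
    s zero * F (B zero) + Σℚ p (λ k → s (suc k) * F (B (suc k))) ∎
    where
    v : Fin n → ℚ
    v j = Σℚ p (λ k → s (suc k) * B (suc k) i j)
    C′ : Rows m n
    C′ = updateAt C i (const v)
    off : ∀ l → l ≢ i → C′ l ≗ C l
    off l l≢i j = cong (λ r → r j) (updateAt-minimal l i C l≢i)
    on : C′ i ≗ v
    on j = cong (λ r → r j) (updateAt-updates i C)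
    split : ∀ j → C i j ≡ s zero * B zero i j + 1ℚ * C′ i j
    split j = trans (row j) (cong (λ x → s zero * B zero i j + x) (sym (trans (*-identityˡ _) (on j))))
    rest : F C′ ≡ Σℚ p (λ k → s (suc k) * F (B (suc k)))
    rest = expand i (s ∘ suc) (B ∘ suc) (λ k l l≢i j → trans (agree (suc k) l l≢i j) (sym (off l l≢i j))) on

record Alternating {m n} (F : Rows m n → ℚ) : Set where
  field
    multilinear : Multilinear F
    alternating : ∀ i i′ {A} → i ≢ i′ → A i ≗ A i′ → F A ≡ 0ℚ
  open Multilinear multilinear public

∷-cong : ∀ {m n} {v w : Fin n → ℚ} {A B : Rows m n} → v ≗ w → A ≋ B → (v ∷ A) ≋ (w ∷ B)
∷-cong v≗w A≋B zero    = v≗w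
∷-cong v≗w A≋B (suc i) = A≋B i

∷-tail : ∀ {m n} (A : Rows (suc m) n) → A ≋ (A zero ∷ tail A)
∷-tail A zero    j = refl
∷-tail A (suc i) j = refl

fix-multilinear : ∀ {m n} {F : Rows (suc m) n → ℚ} → Multilinear F → ∀ v → Multilinear (λ A → F (v ∷ A))
fix-multilinear M v = record
  { congruent = λ A≋B → congruent (∷-cong (λ _ → refl) A≋B)
  ; linear    = λ i s t A≋C B≋C row → linear (suc i) s t (off A≋C) (off B≋C) row
  }
  where
  open Multilinear M
  off : ∀ {A C i} → (∀ l → l ≢ i → A l ≗ C l) → ∀ l → l ≢ suc i → (v ∷ A) l ≗ (v ∷ C) l
  off A≋C zero    l≢i j = refl
  off A≋C (suc l) l≢i j = A≋C l (l≢i ∘ cong suc) j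

fix-alternating : ∀ {m n} {F : Rows (suc m) n → ℚ} → Alternating F → ∀ v → Alternating (λ A → F (v ∷ A))
fix-alternating alt v = record
  { multilinear = fix-multilinear multilinear v
  ; alternating = λ i i′ i≢i′ → alternating (suc i) (suc i′) (i≢i′ ∘ suc-injective)
  }
  where open Alternating alt

-- Polarisation: put v + w into both of the first two rows and expand. The hypothesis concerns these
-- two rows only, so the lemma already applies to `det` when just `det-repeat₀₁` is available.
swap-rows : ∀ {m n} {F : Rows (suc (suc m)) n → ℚ} → Multilinear F →
            (∀ {A} → A zero ≗ A (suc zero) → F A ≡ 0ℚ) →
            ∀ v w R → F (v ∷ w ∷ R) ≡ - F (w ∷ v ∷ R)
swap-rows {m} {n} {F} M vanish v w R = begin
  f v w
    ≡⟨ solve 4 (λ vv vw wv ww → vw := (con 1ℚ :* (con 1ℚ :* vv :+ con 1ℚ :* vw)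
                                    :+ con 1ℚ :* (con 1ℚ :* wv :+ con 1ℚ :* ww)) :- wv :- vv :- ww)
         refl (f v v) (f v w) (f w v) (f w w) ⟩
  (1ℚ * (1ℚ * f v v + 1ℚ * f v w) + 1ℚ * (1ℚ * f w v + 1ℚ * f w w)) + - f w v + - f v v + - f w w
    ≡⟨ cong (λ x → x + - f w v + - f v v + - f w w) (sym polarised) ⟩
  0ℚ + - f w v + - f v v + - f w w
    ≡⟨ cong₂ (λ x y → 0ℚ + - f w v + - x + - y) (vanish (λ _ → refl)) (vanish (λ _ → refl)) ⟩
  0ℚ + - f w v + - 0ℚ + - 0ℚ
    ≡⟨ solve 1 (λ x → con 0ℚ :- x :- con 0ℚ :- con 0ℚ := :- x) refl (f w v) ⟩
  - f w v ∎
  where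
  open Multilinear M
  f : (_ _ : Fin n → ℚ) → ℚ
  f x y = F (x ∷ y ∷ R)
  z : Fin n → ℚ
  z j = 1ℚ * v j + 1ℚ * w j
  off₀ : ∀ {x y z : Fin n → ℚ} l → l ≢ zero → (x ∷ z ∷ R) l ≗ (y ∷ z ∷ R) l
  off₀ zero    l≢ j = contradiction refl l≢
  off₀ (suc l) l≢ j = refl
  off₁ : ∀ {x y z : Fin n → ℚ} l → l ≢ suc zero → (z ∷ x ∷ R) l ≗ (z ∷ y ∷ R) l
  off₁ zero          l≢ j = refl
  off₁ (suc zero)    l≢ j = contradiction refl l≢
  off₁ (suc (suc l)) l≢ j = refl
  second : ∀ x → f x z ≡ 1ℚ * f x v + 1ℚ * f x w
  second x = linear (suc zero) 1ℚ 1ℚ off₁ off₁ (λ _ → refl)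
  polarised : 0ℚ ≡ 1ℚ * (1ℚ * f v v + 1ℚ * f v w) + 1ℚ * (1ℚ * f w v + 1ℚ * f w w)
  polarised = begin
    0ℚ                       ≡⟨ sym (vanish (λ _ → refl)) ⟩
    f z z                    ≡⟨ linear zero 1ℚ 1ℚ off₀ off₀ (λ _ → refl) ⟩
    1ℚ * f v z + 1ℚ * f w z  ≡⟨ cong₂ (λ x y → 1ℚ * x + 1ℚ * y) (second v) (second w) ⟩
    _                        ∎

-- Row `j` passes the rows above it one at a time, each transposition costing a sign. After the swap
-- with the top row, that row is fixed and the induction runs in the tail.
pull-row : ∀ {m n} {F : Rows (suc m) n → ℚ} → Alternating F →
           ∀ j A → F (A j ∷ λ i → A (punchIn j i)) ≡ sgn j * F A
pull-row alt zero A = trans (congruent (λ i j → sym (∷-tail A i j))) (sym (*-identityˡ _))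
  where open Alternating alt
pull-row {suc m} {n} {F} alt (suc j) A = begin
  F (A (suc j) ∷ λ i → A (punchIn (suc j) i))
    ≡⟨ congruent (∷-cong (λ _ → refl) (∷-tail (λ i → A (punchIn (suc j) i)))) ⟩
  F (A (suc j) ∷ A zero ∷ λ i → A (suc (punchIn j i)))
    ≡⟨ swap-rows multilinear (alternating zero (suc zero) (λ ())) _ _ _ ⟩
  - F (A zero ∷ A (suc j) ∷ λ i → A (suc (punchIn j i)))
    ≡⟨ cong -_ (pull-row (fix-alternating alt (A zero)) j (tail A)) ⟩
  - (sgn j * F (A zero ∷ tail A))
    ≡⟨ cong (λ x → - (sgn j * x)) (congruent (λ i j → sym (∷-tail A i j))) ⟩
  - (sgn j * F A)
    ≡⟨ solve 2 (λ s x → :- (s :* x) := :- s :* x) refl (sgn j) (F A) ⟩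
  - sgn j * F A ∎
  where open Alternating alt

-- Passes from altering a single row to altering all of them: the rows of `A` are replaced by those
-- of `B` from the top down.
rowwise : ∀ {m n} (_~_ : (_ _ : Fin n → ℚ) → Set) (H : Rows m n → ℚ) →
          (∀ {A B} → A ≋ B → H A ≡ H B) →
          (∀ i {A B} → (∀ l → l ≢ i → A l ≗ B l) → A i ~ B i → H A ≡ H B) →
          ∀ {A B} → (∀ i → A i ~ B i) → H A ≡ H B
rowwise {zero}  _~_ H cng step A~B = cng (λ ())
rowwise {suc m} _~_ H cng step {A} {B} A~B = begin
  H A                 ≡⟨ step zero {A} {B zero ∷ tail A} off₀ (A~B zero) ⟩
  H (B zero ∷ tail A) ≡⟨ rowwise _~_ (λ R → H (B zero ∷ R)) (cng ∘ ∷-cong (λ _ → refl)) step′ (A~B ∘ suc) ⟩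
  H (B zero ∷ tail B) ≡⟨ cng (λ i j → sym (∷-tail B i j)) ⟩
  H B                 ∎
  where
  off₀ : ∀ l → l ≢ zero → A l ≗ (B zero ∷ tail A) l
  off₀ zero    l≢0 j = contradiction refl l≢0
  off₀ (suc l) l≢0 j = refl
  step′ : ∀ i {R S} → (∀ l → l ≢ i → R l ≗ S l) → R i ~ S i → H (B zero ∷ R) ≡ H (B zero ∷ S)
  step′ i {R} {S} off R~S = step (suc i) off′ R~S
    where
    off′ : ∀ l → l ≢ suc i → (B zero ∷ R) l ≗ (B zero ∷ S) l
    off′ zero    l≢ j = refl
    off′ (suc l) l≢ j = off l (l≢ ∘ cong suc) j

punchIn-elim : ∀ {n} (P : Fin (suc n) → Set) j → P j → (∀ c → P (punchIn j c)) → ∀ c → P c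
punchIn-elim P zero    pj p zero    = pj
punchIn-elim P zero    pj p (suc c) = p c
punchIn-elim {suc n} P (suc j) pj p zero    = p zero
punchIn-elim {suc n} P (suc j) pj p (suc c) = punchIn-elim (P ∘ suc) j pj (p ∘ suc) c

-- With the unit vector `idMat j` among the rows, adding multiples of it to the other rows changes
-- only their column `j`. The correction term has that unit vector twice and so vanishes.
clear-column : ∀ {m n} {F : Rows (suc m) (suc n) → ℚ} → Alternating F →
               ∀ j {A B : Rows m (suc n)} → (∀ i c → A i (punchIn j c) ≡ B i (punchIn j c)) →
               F (idMat j ∷ A) ≡ F (idMat j ∷ B)
clear-column {m} {n} {F} alt j = rowwise
  (λ v w → ∀ c → v (punchIn j c) ≡ w (punchIn j c)) (λ R → F (idMat j ∷ R))
  (congruent ∘ ∷-cong (λ _ → refl)) step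
  where
  open Alternating alt
  step : ∀ i {A B : Rows m (suc n)} → (∀ l → l ≢ i → A l ≗ B l) → (∀ c → A i (punchIn j c) ≡ B i (punchIn j c)) →
         F (idMat j ∷ A) ≡ F (idMat j ∷ B)
  step i {A} {B} off agree = begin
    F (idMat j ∷ A)                      ≡⟨ linear′ i 1ℚ t (λ l l≢i c → sym (off l l≢i c)) offE row ⟩
    1ℚ * F (idMat j ∷ B) + t * F (idMat j ∷ E) ≡⟨ cong (λ x → 1ℚ * F (idMat j ∷ B) + t * x) repeated ⟩
    1ℚ * F (idMat j ∷ B) + t * 0ℚ        ≡⟨ solve 2 (λ x t → con 1ℚ :* x :+ t :* con 0ℚ := x) refl _ t ⟩
    F (idMat j ∷ B)                      ∎
    where
    open Multilinear (fix-multilinear multilinear (idMat j)) using () renaming (linear to linear′)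
    t : ℚ
    t = A i j + - B i j
    E : Rows m (suc n)
    E = updateAt A i (const (idMat j))
    onE : idMat j ≗ E i
    onE c = cong (λ r → r c) (sym (updateAt-updates i A))
    offE : ∀ l → l ≢ i → E l ≗ A l
    offE l l≢i c = cong (λ r → r c) (updateAt-minimal l i A l≢i)
    repeated : F (idMat j ∷ E) ≡ 0ℚ
    repeated = alternating zero (suc i) (λ ()) onE
    row : ∀ c → A i c ≡ 1ℚ * B i c + t * E i c
    row = punchIn-elim _ j
      (trans (solve 2 (λ a b → a := con 1ℚ :* b :+ (a :- b) :* con 1ℚ) refl (A i j) (B i j))
             (cong (λ x → 1ℚ * B i j + t * x) (trans (sym (idMat-diag j)) (onE j))))
      (λ c → trans (trans (agree c) (solve 2 (λ b t → b := con 1ℚ :* b :+ t :* con 0ℚ) refl (B i (punchIn j c)) t))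
             (cong (λ x → 1ℚ * B i (punchIn j c) + t * x)
                   (trans (sym (idMat-off (punchInᵢ≢i j c ∘ sym))) (onE (punchIn j c)))))

insert₀ : ∀ {n} → Fin (suc n) → (Fin n → ℚ) → Fin (suc n) → ℚ
insert₀ j v = insertAt v j 0ℚ

-- Turns a form on matrices of one size into a form on their minors, to which the induction
-- hypothesis of `alternating-unique` applies.
minor-alternating : ∀ {m n} {F : Rows (suc m) (suc n) → ℚ} → Alternating F →
                    ∀ j → Alternating (λ (B : Rows m n) → F (idMat j ∷ λ i → insert₀ j (B i)))
minor-alternating {m} {n} alt j = record
  { multilinear = record
    { congruent = λ A≋B → congruent′ (λ i → insert-cong (A≋B i))
    ; linear    = λ i s t A≋C B≋C row → linear′ i s t
                    (λ l l≢i → insert-cong (A≋C l l≢i)) (λ l l≢i → insert-cong (B≋C l l≢i))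
                    (insert-linear s t row)
    }
  ; alternating = λ i i′ i≢i′ Ai≗Ai′ → alternating′ i i′ i≢i′ (insert-cong Ai≗Ai′)
  }
  where
  open Alternating (fix-alternating alt (idMat j))
    using () renaming (congruent to congruent′; linear to linear′; alternating to alternating′)
  at : ∀ (v : Fin n → ℚ) → insert₀ j v j ≡ 0ℚ
  at v = insertAt-lookup v j 0ℚ
  away : ∀ (v : Fin n → ℚ) c → insert₀ j v (punchIn j c) ≡ v c
  away v c = insertAt-punchIn v j 0ℚ c
  insert-cong : ∀ {v w : Fin n → ℚ} → v ≗ w → insert₀ j v ≗ insert₀ j w
  insert-cong {v} {w} v≗w = punchIn-elim _ j (trans (at v) (sym (at w)))
    (λ c → trans (away v c) (trans (v≗w c) (sym (away w c))))
  insert-linear : ∀ s t {u v w : Fin n → ℚ} → (∀ c → w c ≡ s * u c + t * v c) →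
                  ∀ c → insert₀ j w c ≡ s * insert₀ j u c + t * insert₀ j v c
  insert-linear s t {u} {v} {w} eq = punchIn-elim _ j
    (trans (at w) (trans (solve 2 (λ s t → con 0ℚ := s :* con 0ℚ :+ t :* con 0ℚ) refl s t)
                         (sym (cong₂ (λ x y → s * x + t * y) (at u) (at v)))))
    (λ c → trans (away w c) (trans (eq c)
                         (sym (cong₂ (λ x y → s * x + t * y) (away u c) (away v c)))))

idMat-punchIn : ∀ {n} (j : Fin (suc n)) i c → idMat (punchIn j i) (punchIn j c) ≡ idMat i c
idMat-punchIn zero    i       c       = refl
idMat-punchIn (suc j) zero    zero    = refl
idMat-punchIn (suc j) zero    (suc c) = refl
idMat-punchIn (suc j) (suc i) zero    = refl
idMat-punchIn (suc j) (suc i) (suc c) = idMat-punchIn j i c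

minor : ∀ {n} → Mat ℚ (suc n) → Fin (suc n) → Mat ℚ n
minor A j i c = A (suc i) (punchIn j c)

-- Expanding the first row and clearing the column of its unit vector turns the form into
-- forms on the minors, which reproduces the Laplace recursion.
alternating-unique : ∀ {n} {F : Mat ℚ n → ℚ} → Alternating F → ∀ A → F A ≡ det A * F idMat
alternating-unique {zero}  {F} alt A = trans (congruent (λ ())) (sym (*-identityˡ (F idMat)))
  where open Alternating alt
alternating-unique {suc n} {F} alt A = begin
  F A
    ≡⟨ expand zero (A zero) (λ j → idMat j ∷ tail A) off (λ c → sym (Σ-idʳ c (A zero))) ⟩
  Σℚ (suc n) (λ j → A zero j * F (idMat j ∷ tail A))
    ≡⟨ Σ-cong (λ j → trans (cong (A zero j *_) (term j))
         (solve 4 (λ a s d f → a :* (d :* (s :* f)) := s :* a :* d :* f)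
            refl (A zero j) (sgn j) (det (minor A j)) (F idMat))) ⟩
  Σℚ (suc n) (λ j → sgn j * A zero j * det (minor A j) * F idMat)
    ≡⟨ sym (Σ-distribʳ (F idMat) (λ j → sgn j * A zero j * det (minor A j))) ⟩
  det A * F idMat ∎
  where
  open Alternating alt
  off : ∀ k l → l ≢ zero → (idMat k ∷ tail A) l ≗ A l
  off k zero    l≢0 c = contradiction refl l≢0
  off k (suc l) l≢0 c = refl
  term : ∀ j → F (idMat j ∷ tail A) ≡ det (minor A j) * (sgn j * F idMat)
  term j = begin
    F (idMat j ∷ tail A)
      ≡⟨ clear-column alt j (λ i c → sym (insertAt-punchIn (minor A j i) j 0ℚ c)) ⟩
    F (idMat j ∷ λ i → insert₀ j (minor A j i))
      ≡⟨ alternating-unique (minor-alternating alt j) (minor A j) ⟩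
    det (minor A j) * F (idMat j ∷ λ i → insert₀ j (idMat i))
      ≡⟨ cong (det (minor A j) *_) (clear-column alt j
           (λ i c → trans (insertAt-punchIn (idMat i) j 0ℚ c) (sym (idMat-punchIn j i c)))) ⟩
    det (minor A j) * F (idMat j ∷ λ i → idMat (punchIn j i))
      ≡⟨ cong (det (minor A j) *_) (pull-row alt j idMat) ⟩
    det (minor A j) * (sgn j * F idMat) ∎

-- The determinant

det-cong : ∀ {n} {A B : Mat ℚ n} → A ≈ₘ B → det A ≡ det B
det-cong {zero}  A≈B = refl
det-cong {suc n} A≈B = Σ-cong (λ j → cong₂ (λ x d → sgn j * x * d)
  (A≈B zero j) (det-cong (λ i c → A≈B (suc i) (punchIn j c))))

-- In the first row, linearity is visible in the Laplace expansion, whose minors omit that row. In a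
-- lower row it comes from the minors by induction.
det-linear : ∀ {n} i s t {A B C : Mat ℚ n} →
             (∀ l → l ≢ i → A l ≗ C l) → (∀ l → l ≢ i → B l ≗ C l) →
             (∀ j → C i j ≡ s * A i j + t * B i j) →
             det C ≡ s * det A + t * det B
det-linear {suc n} i s t {A} {B} {C} A≋C B≋C row =
  trans (Σ-cong (term i A≋C B≋C row)) (Σ-linear s t (summand A) (summand B))
  where
  summand : Mat ℚ (suc n) → Fin (suc n) → ℚ
  summand M j = sgn j * M zero j * det (minor M j)
  term : ∀ i → (∀ l → l ≢ i → A l ≗ C l) → (∀ l → l ≢ i → B l ≗ C l) →
         (∀ j → C i j ≡ s * A i j + t * B i j) →
         ∀ j → summand C j ≡ s * summand A j + t * summand B j
  term zero A≋C B≋C row j = begin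
    sgn j * C zero j * det (minor C j)
      ≡⟨ cong (λ x → sgn j * x * det (minor C j)) (row j) ⟩
    sgn j * (s * A zero j + t * B zero j) * det (minor C j)
      ≡⟨ solve 6 (λ σ s t a b d → σ :* (s :* a :+ t :* b) :* d
                             := s :* (σ :* a :* d) :+ t :* (σ :* b :* d))
           refl (sgn j) s t (A zero j) (B zero j) (det (minor C j)) ⟩
    s * (sgn j * A zero j * det (minor C j)) + t * (sgn j * B zero j * det (minor C j))
      ≡⟨ cong₂ (λ x y → s * (sgn j * A zero j * x) + t * (sgn j * B zero j * y))
           (det-cong (λ l c → sym (A≋C (suc l) (λ ()) (punchIn j c))))
           (det-cong (λ l c → sym (B≋C (suc l) (λ ()) (punchIn j c)))) ⟩
    s * summand A j + t * summand B j ∎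
  term (suc i) A≋C B≋C row j = begin
    sgn j * C zero j * det (minor C j)
      ≡⟨ cong (sgn j * C zero j *_) (det-linear i s t
           (λ l l≢i c → A≋C (suc l) (l≢i ∘ suc-injective) (punchIn j c))
           (λ l l≢i c → B≋C (suc l) (l≢i ∘ suc-injective) (punchIn j c))
           (λ c → row (punchIn j c))) ⟩
    sgn j * C zero j * (s * det (minor A j) + t * det (minor B j))
      ≡⟨ solve 6 (λ σ x s t a b → σ :* x :* (s :* a :+ t :* b)
                             := s :* (σ :* x :* a) :+ t :* (σ :* x :* b))
           refl (sgn j) (C zero j) s t (det (minor A j)) (det (minor B j)) ⟩
    s * (sgn j * C zero j * det (minor A j)) + t * (sgn j * C zero j * det (minor B j))
      ≡⟨ cong₂ (λ x y → s * (sgn j * x * det (minor A j)) + t * (sgn j * y * det (minor B j)))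
           (sym (A≋C zero (λ ()) j)) (sym (B≋C zero (λ ()) j)) ⟩
    s * summand A j + t * summand B j ∎

det-multilinear : ∀ {n} → Multilinear (det {n})
det-multilinear = record { congruent = det-cong ; linear = det-linear }

-- Opposite j k j′ k′ says that j, punchIn j k and j′, punchIn j′ k′ are the same two columns
-- removed in opposite orders.
data Opposite : ∀ {n} → (j : Fin (suc (suc n))) (k : Fin (suc n)) (j′ : Fin (suc (suc n))) (k′ : Fin (suc n)) → Set where
  base : ∀ {n} {k : Fin (suc n)} → Opposite zero k (suc k) zero
  step : ∀ {n} {j k j′ k′} → Opposite {n} j k j′ k′ → Opposite (suc j) (suc k) (suc j′) (suc k′)

opposite-first : ∀ {n j k j′ k′} → Opposite {n} j k j′ k′ → punchIn j k ≡ j′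
opposite-first base     = refl
opposite-first (step o) = cong suc (opposite-first o)

opposite-second : ∀ {n j k j′ k′} → Opposite {n} j k j′ k′ → punchIn j′ k′ ≡ j
opposite-second base     = refl
opposite-second (step o) = cong suc (opposite-second o)

opposite-rest : ∀ {n j k j′ k′} → Opposite {n} j k j′ k′ →
                ∀ c → punchIn j (punchIn k c) ≡ punchIn j′ (punchIn k′ c)
opposite-rest base     c       = refl
opposite-rest (step o) zero    = refl
opposite-rest (step o) (suc c) = cong suc (opposite-rest o c)

-- Opposite pairs carry opposite signs. The terms with `j` zero cancel those with `k` zero; in all
-- other terms both indices are successors, the two extra signs cancel, and the smaller case
-- applies.
opposite-cancel : ∀ {n} (a : Fin (suc (suc n)) → Fin (suc n) → ℚ) →
                  (∀ {j k j′ k′} → Opposite j k j′ k′ → a j k ≡ a j′ k′) →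
                  Σℚ (suc (suc n)) (λ j → Σℚ (suc n) (λ k → sgn j * (sgn k * a j k))) ≡ 0ℚ
opposite-cancel {n} a sym-a = begin
  X + Σℚ (suc n) (λ j → sgn (suc j) * (1ℚ * a (suc j) zero) + inner j)
    ≡⟨ cong (λ x → X + x) (Σ-+ (λ j → sgn (suc j) * (1ℚ * a (suc j) zero)) inner) ⟩
  X + (Σℚ (suc n) (λ j → sgn (suc j) * (1ℚ * a (suc j) zero)) + Σℚ (suc n) inner)
    ≡⟨ cong₂ (λ y z → X + (y + z)) negated (remaining n a sym-a) ⟩
  X + (- 1ℚ * X + 0ℚ)
    ≡⟨ solve 1 (λ x → x :+ (:- con 1ℚ :* x :+ con 0ℚ) := con 0ℚ) refl X ⟩
  0ℚ ∎
  where
  X : ℚ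
  X = Σℚ (suc n) (λ k → 1ℚ * (sgn k * a zero k))
  inner : Fin (suc n) → ℚ
  inner j = Σℚ n (λ k → sgn (suc j) * (sgn (suc k) * a (suc j) (suc k)))
  negated : Σℚ (suc n) (λ j → sgn (suc j) * (1ℚ * a (suc j) zero)) ≡ - 1ℚ * X
  negated = trans
    (Σ-cong (λ j → trans
      (cong (λ x → - sgn j * (1ℚ * x)) (sym (sym-a {zero} {j} base)))
      (solve 2 (λ s x → :- s :* (con 1ℚ :* x) := :- con 1ℚ :* (con 1ℚ :* (s :* x))) refl (sgn j) (a zero j))))
    (sym (Σ-distribˡ (- 1ℚ) (λ k → 1ℚ * (sgn k * a zero k))))
  remaining : ∀ n (a : Fin (suc (suc n)) → Fin (suc n) → ℚ) →
              (∀ {j k j′ k′} → Opposite j k j′ k′ → a j k ≡ a j′ k′) →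
              Σℚ (suc n) (λ j → Σℚ n (λ k → sgn (suc j) * (sgn (suc k) * a (suc j) (suc k)))) ≡ 0ℚ
  remaining zero    a sym-a = Σ-zero {1} (λ j → refl)
  remaining (suc n) a sym-a = trans
    (Σ-cong (λ j → Σ-cong (λ k →
      solve 3 (λ s t x → :- s :* (:- t :* x) := s :* (t :* x)) refl (sgn j) (sgn k) (a (suc j) (suc k)))))
    (opposite-cancel (λ j k → a (suc j) (suc k)) (sym-a ∘ step))

-- In the expansion along the first two rows, removing the same two columns in the other order only
-- exchanges the two row entries, which leaves their product unchanged when the rows agree.
det-repeat₀₁ : ∀ {n} (A : Mat ℚ (suc (suc n))) → A zero ≗ A (suc zero) → det A ≡ 0ℚ
det-repeat₀₁ {n} A A₀≗A₁ = trans
  (Σ-cong (λ j → trans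
    (Σ-distribˡ (sgn j * A zero j) (λ k → sgn k * A (suc zero) (punchIn j k) * D j k))
    (Σ-cong (λ k → solve 5 (λ s x t y d → s :* x :* (t :* y :* d) := s :* (t :* (x :* y :* d)))
       refl (sgn j) (A zero j) (sgn k) (A (suc zero) (punchIn j k)) (D j k)))))
  (opposite-cancel a sym-a)
  where
  D : Fin (suc (suc n)) → Fin (suc n) → ℚ
  D j k = det (minor (minor A j) k)
  a : Fin (suc (suc n)) → Fin (suc n) → ℚ
  a j k = A zero j * A (suc zero) (punchIn j k) * D j k
  sym-a : ∀ {j k j′ k′} → Opposite j k j′ k′ → a j k ≡ a j′ k′
  sym-a {j} {k} {j′} {k′} o = begin
    A zero j * A (suc zero) (punchIn j k) * D j k
      ≡⟨ cong₂ (λ x y → A zero x * A (suc zero) y * D j k) (sym (opposite-second o)) (opposite-first o) ⟩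
    A zero (punchIn j′ k′) * A (suc zero) j′ * D j k
      ≡⟨ cong₂ (λ x y → x * y * D j k) (A₀≗A₁ (punchIn j′ k′)) (sym (A₀≗A₁ j′)) ⟩
    A (suc zero) (punchIn j′ k′) * A zero j′ * D j k
      ≡⟨ cong₂ _*_ (solve 2 (λ x y → x :* y := y :* x) refl (A (suc zero) (punchIn j′ k′)) (A zero j′))
           (det-cong (λ i c → cong (A (suc (suc i))) (opposite-rest o c))) ⟩
    a j′ k′ ∎

RepeatVanishes : ℕ → Set
RepeatVanishes n = ∀ (i i′ : Fin n) (A : Mat ℚ n) → i ≢ i′ → A i ≗ A i′ → det A ≡ 0ℚ

det-repeat-lower : ∀ {n} → RepeatVanishes n → ∀ i i′ (A : Mat ℚ (suc n)) → i ≢ i′ →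
                   A (suc i) ≗ A (suc i′) → det A ≡ 0ℚ
det-repeat-lower vanish i i′ A i≢i′ eq = Σ-zero (λ j → trans
  (cong (sgn j * A zero j *_) (vanish i i′ (minor A j) i≢i′ (λ c → eq (punchIn j c))))
  (*-zeroʳ (sgn j * A zero j)))

-- If the repeated row is not adjacent to the first, swapping the first two rows moves both copies
-- below the top row, where every minor contains them.
det-repeat-first : ∀ {n} → RepeatVanishes (suc n) → ∀ i (A : Mat ℚ (suc (suc n))) →
                   A zero ≗ A (suc i) → det A ≡ 0ℚ
det-repeat-first {n} vanish zero    A eq = det-repeat₀₁ A eq
det-repeat-first {n} vanish (suc i) A eq = begin
  det A
    ≡⟨ det-cong (λ l c → trans (∷-tail A l c) (∷-cong (λ _ → refl) (∷-tail (tail A)) l c)) ⟩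
  det (A zero ∷ A (suc zero) ∷ R)
    ≡⟨ swap-rows det-multilinear (λ {M} → det-repeat₀₁ M) (A zero) (A (suc zero)) R ⟩
  - det (A (suc zero) ∷ A zero ∷ R)
    ≡⟨ cong -_ (det-repeat-lower vanish zero (suc i) (A (suc zero) ∷ A zero ∷ R) (λ ()) eq) ⟩
  0ℚ ∎
  where
  R : Rows n (suc (suc n))
  R = tail (tail A)

det-repeat : ∀ {n} → RepeatVanishes n
det-repeat {suc n}       zero    zero     A i≢i′ eq = contradiction refl i≢i′
det-repeat {suc n}       (suc i) (suc i′) A i≢i′ eq = det-repeat-lower det-repeat i i′ A (i≢i′ ∘ cong suc) eq
det-repeat {suc (suc n)} zero    (suc i′) A i≢i′ eq = det-repeat-first det-repeat i′ A eq
det-repeat {suc (suc n)} (suc i) zero     A i≢i′ eq = det-repeat-first det-repeat i A (sym ∘ eq)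

det-id : ∀ {n} → det (idMat {n}) ≡ 1ℚ
det-id {zero}  = refl
det-id {suc n} = begin
  1ℚ * 1ℚ * det (idMat {n}) + Σℚ n (λ j → sgn (suc j) * 0ℚ * det (minor (idMat {suc n}) (suc j)))
    ≡⟨ cong₂ _+_ (cong (1ℚ * 1ℚ *_) (det-id {n})) (Σ-zero (λ j →
         solve 2 (λ s d → s :* con 0ℚ :* d := con 0ℚ) refl (sgn (suc j)) (det (minor (idMat {suc n}) (suc j))))) ⟩
  1ℚ ∎

-- As a function of its left factor the determinant of a product is alternating, so
-- `alternating-unique` determines it from its value at the identity.
det-⊗ : ∀ {n} (A B : Mat ℚ n) → det (A ⊗ B) ≡ det A * det B
det-⊗ {n} A B = trans (alternating-unique product-alternating A)
                      (cong (det A *_) (det-cong (⊗-identityˡ B)))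
  where
  product-alternating : Alternating (λ M → det (M ⊗ B))
  product-alternating = record
    { multilinear = record
      { congruent = λ M≋M′ → det-cong (⊗-cong M≋M′ (λ _ _ → refl))
      ; linear    = λ i s t {M} {M′} {M″} M≋M″ M′≋M″ row → det-linear i s t
          (λ l l≢i c → Σ-cong (λ k → cong (_* B k c) (M≋M″ l l≢i k)))
          (λ l l≢i c → Σ-cong (λ k → cong (_* B k c) (M′≋M″ l l≢i k)))
          (λ c → trans
            (Σ-cong (λ k → trans (cong (_* B k c) (row k))
              (solve 5 (λ s t x y b → (s :* x :+ t :* y) :* b := s :* (x :* b) :+ t :* (y :* b))
                 refl s t (M i k) (M′ i k) (B k c))))
            (Σ-linear s t (λ k → M i k * B k c) (λ k → M′ i k * B k c)))
      }
    ; alternating = λ i i′ i≢i′ Mi≗Mi′ → det-repeat i i′ _ i≢i′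
        (λ c → Σ-cong (λ k → cong (_* B k c) (Mi≗Mi′ k)))
    }

-- Row `i` of the hypothesis writes the unit vector as a combination of the rows of `B` with
-- coefficients `A i k`. Substituted for row `j` of `B`, every summand but k = j has a repeated row.
cramer : ∀ {n} {A B : Mat ℚ n} → A ⊗ B ≈ₘ idMat →
         ∀ i j → A i j * det B ≡ det (updateAt B j (const (idMat i)))
cramer {n} {A} {B} AB≈1 i j = sym (begin
  det C                              ≡⟨ expand j (A i) (λ k → row k) off on ⟩
  Σℚ n (λ k → A i k * det (row k))   ≡⟨ Σ-cong (λ k → trans (cong (A i k *_) (det-row k))
       (solve 3 (λ a e d → a :* (e :* d) := a :* d :* e) refl (A i k) (idMat k j) (det B))) ⟩
  Σℚ n (λ k → A i k * det B * idMat k j) ≡⟨ Σ-idʳ j (λ k → A i k * det B) ⟩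
  A i j * det B                      ∎)
  where
  open Multilinear det-multilinear
  C : Mat ℚ n
  C = updateAt B j (const (idMat i))
  row : Fin n → Mat ℚ n
  row k = updateAt B j (const (B k))
  row-at : ∀ k → row k j ≗ B k
  row-at k c = cong (λ r → r c) (updateAt-updates j B)
  row-off : ∀ k l → l ≢ j → row k l ≗ B l
  row-off k l l≢j c = cong (λ r → r c) (updateAt-minimal l j B l≢j)
  off : ∀ k l → l ≢ j → row k l ≗ C l
  off k l l≢j c = trans (row-off k l l≢j c) (cong (λ r → r c) (sym (updateAt-minimal l j B l≢j)))
  on : ∀ c → C j c ≡ Σℚ n (λ k → A i k * row k j c)
  on c = begin
    C j c                          ≡⟨ cong (λ r → r c) (updateAt-updates j B) ⟩
    idMat i c                      ≡⟨ sym (AB≈1 i c) ⟩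
    Σℚ n (λ k → A i k * B k c)     ≡⟨ Σ-cong (λ k → cong (A i k *_) (sym (row-at k c))) ⟩
    Σℚ n (λ k → A i k * row k j c) ∎
  det-row : ∀ k → det (row k) ≡ idMat k j * det B
  det-row k with k ≟ j
  ... | yes refl = trans (det-cong same) (sym (trans (cong (_* det B) (idMat-diag k)) (*-identityˡ (det B))))
    where
    same : row k ≈ₘ B
    same l c with l ≟ k
    ... | yes refl = row-at k c
    ... | no l≢k   = row-off k l l≢k c
  ... | no k≢j = trans
    (det-repeat k j (row k) k≢j (λ c → trans (row-off k k k≢j c) (sym (row-at k c))))
    (sym (trans (cong (_* det B) (idMat-off k≢j)) (*-zeroˡ (det B))))

-- The factor is the `n`-th power of `q`, built along the recursion together with its positivity.
det-scale : ∀ {n} q → q > 0ℚ → ∃ λ p → p > 0ℚ × (∀ (A : Mat ℚ n) → det (q ·ₘ A) ≡ p * det A)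
det-scale {zero}  q q>0 = 1ℚ , positive⁻¹ 1ℚ , λ A → refl
det-scale {suc n} q q>0 with det-scale {n} q q>0
... | p , p>0 , scales = q * p , *-pos q>0 p>0 , λ A → trans
  (Σ-cong (λ j → trans
    (cong (sgn j * (q * A zero j) *_) (scales (minor A j)))
    (solve 5 (λ s q x p d → s :* (q :* x) :* (p :* d) := q :* p :* (s :* x :* d))
       refl (sgn j) q (A zero j) p (det (minor A j)))))
  (sym (Σ-distribˡ (q * p) (λ j → sgn j * A zero j * det (minor A j))))
  where
  *-pos : ∀ {x y} → x > 0ℚ → y > 0ℚ → x * y > 0ℚ
  *-pos {x} {y} x>0 y>0 = positive⁻¹ (x * y) {{pos*pos⇒pos x {{positive x>0}} y {{positive y>0}}}}

-- Subgroups of ℚ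

open import Relation.Binary.Reasoning.Setoid ℚᵘ.≃-setoid
  using (step-≈-⟩) renaming (begin_ to begin-≃_; _∎ to _∎≃)

ι : ℤ → ℚ
ι z = z / 1

toℚᵘ-/ : ∀ i n → ℚ.toℚᵘ (i / suc n) ℚᵘ.≃ ℚᵘ.mkℚᵘ i n
toℚᵘ-/ i n = toℚᵘ-fromℚᵘ (ℚᵘ.mkℚᵘ i n)

ι-+ : ∀ a b → ι (a ℤ.+ b) ≡ ι a + ι b
ι-+ a b = toℚᵘ-injective (begin-≃
  ℚ.toℚᵘ (ι (a ℤ.+ b))            ≈⟨ toℚᵘ-/ (a ℤ.+ b) 0 ⟩
  ℚᵘ.mkℚᵘ (a ℤ.+ b) 0             ≈⟨ ℚᵘ.*≡* (cong (ℤ._* + 1) (cong₂ ℤ._+_ (sym (ℤ.*-identityʳ a)) (sym (ℤ.*-identityʳ b)))) ⟩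
  ℚᵘ.mkℚᵘ a 0 ℚᵘ.+ ℚᵘ.mkℚᵘ b 0    ≈⟨ ℚᵘ.≃-sym (ℚᵘ.+-cong (toℚᵘ-/ a 0) (toℚᵘ-/ b 0)) ⟩
  ℚ.toℚᵘ (ι a) ℚᵘ.+ ℚ.toℚᵘ (ι b)  ≈⟨ ℚᵘ.≃-sym (toℚᵘ-homo-+ (ι a) (ι b)) ⟩
  ℚ.toℚᵘ (ι a + ι b)              ∎≃)

/-as-* : ∀ i n → i / suc n ≡ ι i * (+ 1 / suc n)
/-as-* i n = toℚᵘ-injective (begin-≃
  ℚ.toℚᵘ (i / suc n)                        ≈⟨ toℚᵘ-/ i n ⟩
  ℚᵘ.mkℚᵘ i n                               ≈⟨ ℚᵘ.*≡* (cong₂ ℤ._*_ (sym (ℤ.*-identityʳ i)) (cong +_ (ℕ.*-identityˡ (suc n)))) ⟩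
  ℚᵘ.mkℚᵘ i 0 ℚᵘ.* ℚᵘ.mkℚᵘ (+ 1) n          ≈⟨ ℚᵘ.≃-sym (ℚᵘ.*-cong (toℚᵘ-/ i 0) (toℚᵘ-/ (+ 1) n)) ⟩
  ℚ.toℚᵘ (ι i) ℚᵘ.* ℚ.toℚᵘ (+ 1 / suc n)    ≈⟨ ℚᵘ.≃-sym (toℚᵘ-homo-* (ι i) (+ 1 / suc n)) ⟩
  ℚ.toℚᵘ (ι i * (+ 1 / suc n))              ∎≃)

ι-* : ∀ a b → ι (a ℤ.* b) ≡ ι a * ι b
ι-* a b = toℚᵘ-injective (begin-≃
  ℚ.toℚᵘ (ι (a ℤ.* b))            ≈⟨ toℚᵘ-/ (a ℤ.* b) 0 ⟩
  ℚᵘ.mkℚᵘ a 0 ℚᵘ.* ℚᵘ.mkℚᵘ b 0    ≈⟨ ℚᵘ.≃-sym (ℚᵘ.*-cong (toℚᵘ-/ a 0) (toℚᵘ-/ b 0)) ⟩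
  ℚ.toℚᵘ (ι a) ℚᵘ.* ℚ.toℚᵘ (ι b)  ≈⟨ ℚᵘ.≃-sym (toℚᵘ-homo-* (ι a) (ι b)) ⟩
  ℚ.toℚᵘ (ι a * ι b)              ∎≃)

ι-injective : ∀ {a b} → ι a ≡ ι b → a ≡ b
ι-injective {a} {b} eq with fromℚᵘ-injective {ℚᵘ.mkℚᵘ a 0} {ℚᵘ.mkℚᵘ b 0} eq
... | ℚᵘ.*≡* a*1≡b*1 = ℤ.*-cancelʳ-≡ a b (+ 1) a*1≡b*1

-- A common interface for integrality, divisibility by `N`, the entries allowed at a position of the
-- order, and preimages of these under multiplication.
record Submodule (P : ℚ → Set) : Set where
  field
    zero∈ : P 0ℚ
    plus  : ∀ {x y} → P x → P y → P (x + y)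
    scale : ∀ z {x} → P x → P (ι z * x)

  minus : ∀ {x y} → P x → P y → P (x + - y)
  minus {x} {y} Px Py = subst P
    (solve 2 (λ x y → x :+ :- con 1ℚ :* y := x :- y) refl x y) (plus Px (scale (ℤ.- + 1) Py))

  sum : ∀ {n} {f : Fin n → ℚ} → (∀ i → P (f i)) → P (Σℚ n f)
  sum {zero}  Pf = zero∈
  sum {suc n} Pf = plus (Pf zero) (sum (Pf ∘ suc))

  -- Serves where a whole sum is known and all terms but one are controlled: it yields the remaining
  -- term modulo `P`.
  sum-except : ∀ {n} l {f : Fin n → ℚ} → (∀ i → i ≢ l → P (f i)) → P (Σℚ n f + - f l)
  sum-except {suc n} zero {f} Pf = subst P
    (solve 2 (λ a b → b := a :+ b :- a) refl (f zero) (Σℚ n (f ∘ suc)))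
    (sum (λ i → Pf (suc i) (λ ())))
  sum-except {suc n} (suc l) {f} Pf = subst P
    (solve 3 (λ a b c → a :+ (b :- c) := a :+ b :- c) refl (f zero) (Σℚ n (f ∘ suc)) (f (suc l)))
    (plus (Pf zero (λ ())) (sum-except l (λ i i≢l → Pf (suc i) (i≢l ∘ suc-injective))))

IsInt : ℚ → Set
IsInt x = ∃ λ z → x ≡ ι z

IsMultiple : ℕ → ℚ → Set
IsMultiple N x = ∃ λ z → x ≡ ι (z ℤ.* + N)

multiple-submodule : ∀ N → Submodule (IsMultiple N)
multiple-submodule N = record
  { zero∈ = + 0 , refl
  ; plus  = λ { (a , refl) (b , refl) → a ℤ.+ b ,
      trans (sym (ι-+ (a ℤ.* + N) (b ℤ.* + N))) (cong ι (sym (ℤ.*-distribʳ-+ (+ N) a b))) }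
  ; scale = λ { z (a , refl) → z ℤ.* a ,
      trans (sym (ι-* z (a ℤ.* + N))) (cong ι (sym (ℤ.*-assoc z a (+ N)))) }
  }

int-submodule : Submodule IsInt
int-submodule = record
  { zero∈ = + 0 , refl
  ; plus  = λ { (a , refl) (b , refl) → a ℤ.+ b , sym (ι-+ a b) }
  ; scale = λ { z (a , refl) → z ℤ.* a , sym (ι-* z a) }
  }

preimage-submodule : ∀ {P} x → Submodule P → Submodule (λ y → P (x * y))
preimage-submodule {P} x S = record
  { zero∈ = subst P (sym (*-zeroʳ x)) zero∈
  ; plus  = λ {y} {z} Py Pz → subst P (sym (*-distribˡ-+ x y z)) (plus Py Pz)
  ; scale = λ z {y} Py → subst P (solve 3 (λ z x y → z :* (x :* y) := x :* (z :* y)) refl (ι z) x y) (scale z Py)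
  }
  where open Submodule S

int-* : ∀ {x y} → IsInt x → IsInt y → IsInt (x * y)
int-* (a , refl) int-y = Submodule.scale int-submodule a int-y

multiple-*ˡ : ∀ {N x y} → IsInt x → IsMultiple N y → IsMultiple N (x * y)
multiple-*ˡ {N} (a , refl) mult-y = Submodule.scale (multiple-submodule N) a mult-y

multiple-*ʳ : ∀ {N x y} → IsMultiple N x → IsInt y → IsMultiple N (x * y)
multiple-*ʳ {N} {x} {y} mult-x int-y = subst (IsMultiple N) (*-comm y x) (multiple-*ˡ int-y mult-x)

idMat-int : ∀ {n} (i j : Fin n) → IsInt (idMat i j)
idMat-int zero    zero    = + 1 , refl
idMat-int zero    (suc j) = + 0 , refl
idMat-int (suc i) zero    = + 0 , refl
idMat-int (suc i) (suc j) = idMat-int i j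

sgn-int : ∀ {n} (j : Fin n) → IsInt (sgn j)
sgn-int zero    = + 1 , refl
sgn-int (suc j) = subst IsInt (solve 1 (λ s → con 0ℚ :- s := :- s) refl (sgn j))
  (Submodule.minus int-submodule (+ 0 , refl) (sgn-int j))

det-int : ∀ {n} {A : Mat ℚ n} → (∀ i j → IsInt (A i j)) → IsInt (det A)
det-int {zero}  int-A = + 1 , refl
det-int {suc n} int-A = Submodule.sum int-submodule (λ j →
  int-* (int-* (sgn-int j) (int-A zero j)) (det-int (λ i c → int-A (suc i) (punchIn j c))))

-- Bézout

abs-unit : ∀ a → ∃ λ e → + ∣ a ∣ ≡ e ℤ.* a × a ≡ e ℤ.* + ∣ a ∣
abs-unit (+ n)      = + 1 , sym (ℤ.*-identityˡ (+ n)) , sym (ℤ.*-identityˡ (+ n))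
abs-unit -[1+ n ]   = ℤ.- + 1 , sym (ℤ.-1*i≡-i -[1+ n ]) , sym (ℤ.-1*i≡-i (+ suc n))

-- These fields say that `d` generates the ideal spanned by `a` and `b`; its sign is left open.
record Gcdℤ (a b : ℤ) : Set where
  field
    d u v s t : ℤ
    left      : a ≡ s ℤ.* d
    right     : b ≡ t ℤ.* d
    combine   : d ≡ u ℤ.* a ℤ.+ v ℤ.* b

bézout : ∀ a b → Gcdℤ a b
bézout a b with Bézout.lemma (∣ a ∣) (∣ b ∣) | abs-unit a | abs-unit b
... | Bézout.result d isGCD identity | e , ∣a∣≡ea , a≡e∣a∣ | f , ∣b∣≡fb , b≡f∣b∣ with GCD.commonDivisor isGCD
... | ℕ.divides p ∣a∣≡pd , ℕ.divides r ∣b∣≡rd = record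
  { d = + d ; u = proj₁ (coefficients identity) ; v = proj₁ (proj₂ (coefficients identity))
  ; s = e ℤ.* + p ; t = f ℤ.* + r
  ; left    = trans a≡e∣a∣ (trans (cong (e ℤ.*_) (trans (cong +_ ∣a∣≡pd) (ℤ.pos-* p d))) (sym (ℤ.*-assoc e (+ p) (+ d))))
  ; right   = trans b≡f∣b∣ (trans (cong (f ℤ.*_) (trans (cong +_ ∣b∣≡rd) (ℤ.pos-* r d))) (sym (ℤ.*-assoc f (+ r) (+ d))))
  ; combine = proj₂ (proj₂ (coefficients identity))
  }
  where
  module Z = Data.Integer.Solver.+-*-Solver
  -- Bézout over the naturals avoids subtraction by moving the negative term across the equation;
  -- here it is moved back.
  lift : ∀ x m y n → d ℕ.+ y ℕ.* n ≡ x ℕ.* m → + d ≡ + x ℤ.* + m ℤ.+ ℤ.- + y ℤ.* + n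
  lift x m y n eq = begin
    + d
      ≡⟨ Z.solve 3 (λ d y n → d Z.:= d Z.:+ y Z.:* n Z.:+ Z.:- y Z.:* n) refl (+ d) (+ y) (+ n) ⟩
    + d ℤ.+ + y ℤ.* + n ℤ.+ ℤ.- + y ℤ.* + n
      ≡⟨ cong (λ z → + d ℤ.+ z ℤ.+ ℤ.- + y ℤ.* + n) (sym (ℤ.pos-* y n)) ⟩
    + (d ℕ.+ y ℕ.* n) ℤ.+ ℤ.- + y ℤ.* + n
      ≡⟨ cong (ℤ._+ ℤ.- + y ℤ.* + n) (trans (cong +_ eq) (ℤ.pos-* x m)) ⟩
    + x ℤ.* + m ℤ.+ ℤ.- + y ℤ.* + n ∎
  coefficients : Bézout.Identity d (∣ a ∣) (∣ b ∣) → ∃ λ u → ∃ λ v → + d ≡ u ℤ.* a ℤ.+ v ℤ.* b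
  coefficients (Bézout.+- x y eq) = + x ℤ.* e , ℤ.- + y ℤ.* f , trans (lift x (∣ a ∣) y (∣ b ∣) eq)
    (cong₂ ℤ._+_ (trans (cong (+ x ℤ.*_) ∣a∣≡ea) (sym (ℤ.*-assoc (+ x) e a)))
                 (trans (cong (ℤ.- + y ℤ.*_) ∣b∣≡fb) (sym (ℤ.*-assoc (ℤ.- + y) f b))))
  coefficients (Bézout.-+ x y eq) = ℤ.- + x ℤ.* e , + y ℤ.* f , trans (lift y (∣ b ∣) x (∣ a ∣) eq) (trans
    (cong₂ ℤ._+_ (trans (cong (+ y ℤ.*_) ∣b∣≡fb) (sym (ℤ.*-assoc (+ y) f b)))
                 (trans (cong (ℤ.- + x ℤ.*_) ∣a∣≡ea) (sym (ℤ.*-assoc (ℤ.- + x) e a))))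
    (ℤ.+-comm (+ y ℤ.* f ℤ.* b) (ℤ.- + x ℤ.* e ℤ.* a)))

-- Greatest common divisors and contents over the rationals

record Gcdℚ (x y : ℚ) : Set where
  field
    q       : ℚ
    u v s t : ℤ
    left    : x ≡ ι s * q
    right   : y ≡ ι t * q
    combine : q ≡ ι u * x + ι v * y

common-unit : ∀ x y → ∃ λ ε → ∃ λ a → ∃ λ b → x ≡ ι a * ε × y ≡ ι b * ε
-- The reciprocal of the product of the two denominators.
common-unit x y = unit x * unit y , ℚ.↥ x ℤ.* ℚ.↧ y , ℚ.↥ y ℤ.* ℚ.↧ x , left , right
  where
  unit : ℚ → ℚ
  unit x = + 1 / ℚ.↧ₙ x
  fraction : ∀ x → x ≡ ι (ℚ.↥ x) * unit x
  fraction x@record{} = trans (sym (↥p/↧p≡p x)) (/-as-* (ℚ.↥ x) (ℚ.ℚ.denominator-1 x))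
  unit-inverse : ∀ x → 1ℚ ≡ ι (ℚ.↧ x) * unit x
  unit-inverse x@record{} = trans
    (sym (fromℚᵘ-cong {ℚᵘ.mkℚᵘ (ℚ.↧ x) (ℚ.ℚ.denominator-1 x)} {ℚᵘ.mkℚᵘ (+ 1) 0}
           (ℚᵘ.*≡* (ℤ.*-comm (ℚ.↧ x) (+ 1)))))
    (/-as-* (ℚ.↧ x) (ℚ.ℚ.denominator-1 x))
  expand-by : ∀ x y → x ≡ ι (ℚ.↥ x ℤ.* ℚ.↧ y) * (unit x * unit y)
  expand-by x y = begin
    x                                               ≡⟨ fraction x ⟩
    ι (ℚ.↥ x) * unit x                              ≡⟨ sym (*-identityʳ (ι (ℚ.↥ x) * unit x)) ⟩
    ι (ℚ.↥ x) * unit x * 1ℚ                         ≡⟨ cong (ι (ℚ.↥ x) * unit x *_) (unit-inverse y) ⟩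
    ι (ℚ.↥ x) * unit x * (ι (ℚ.↧ y) * unit y)
      ≡⟨ solve 4 (λ a e b f → a :* e :* (b :* f) := a :* b :* (e :* f)) refl (ι (ℚ.↥ x)) (unit x) (ι (ℚ.↧ y)) (unit y) ⟩
    ι (ℚ.↥ x) * ι (ℚ.↧ y) * (unit x * unit y)       ≡⟨ cong (_* (unit x * unit y)) (sym (ι-* (ℚ.↥ x) (ℚ.↧ y))) ⟩
    ι (ℚ.↥ x ℤ.* ℚ.↧ y) * (unit x * unit y)         ∎
  left : x ≡ ι (ℚ.↥ x ℤ.* ℚ.↧ y) * (unit x * unit y)
  left = expand-by x y
  right : y ≡ ι (ℚ.↥ y ℤ.* ℚ.↧ x) * (unit x * unit y)
  right = trans (expand-by y x) (cong (ι (ℚ.↥ y ℤ.* ℚ.↧ x) *_) (*-comm (unit y) (unit x)))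

gcd-multiples : ∀ {x y a b} ε → Gcdℤ a b → x ≡ ι a * ε → y ≡ ι b * ε → Gcdℚ x y
gcd-multiples {x} {y} {a} {b} ε gcd x≡aε y≡bε = record
  { q = ι d * ε ; u = u ; v = v ; s = s ; t = t
  ; left    = trans x≡aε (multiple s left)
  ; right   = trans y≡bε (multiple t right)
  ; combine = begin
      ι d * ε                              ≡⟨ cong (λ z → ι z * ε) combine ⟩
      ι (u ℤ.* a ℤ.+ v ℤ.* b) * ε          ≡⟨ cong (_* ε) (trans (ι-+ (u ℤ.* a) (v ℤ.* b)) (cong₂ _+_ (ι-* u a) (ι-* v b))) ⟩
      (ι u * ι a + ι v * ι b) * ε
        ≡⟨ solve 5 (λ u a v b e → (u :* a :+ v :* b) :* e := u :* (a :* e) :+ v :* (b :* e)) refl (ι u) (ι a) (ι v) (ι b) ε ⟩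
      ι u * (ι a * ε) + ι v * (ι b * ε)    ≡⟨ cong₂ (λ x y → ι u * x + ι v * y) (sym x≡aε) (sym y≡bε) ⟩
      ι u * x + ι v * y                    ∎
  }
  where
  open Gcdℤ gcd
  multiple : ∀ {c} s → c ≡ s ℤ.* d → ι c * ε ≡ ι s * (ι d * ε)
  multiple {c} s eq = trans (cong (_* ε) (trans (cong ι eq) (ι-* s d))) (*-assoc (ι s) (ι d) ε)

-- Abstract because unfolding the Euclidean algorithm exhausts memory in later conversion checks.
abstract
  gcdℚ : ∀ x y → Gcdℚ x y
  gcdℚ x y =
    let ε , a , b , x≡aε , y≡bε = common-unit x y
    in gcd-multiples ε (bézout a b) x≡aε y≡bε

-- A generator of the subgroup spanned by the family. Membership in the span is stated as an
-- induction principle over submodules, so properties of the family pass to the generator without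
-- explicit coefficients.
record Content {I : Set} (f : I → ℚ) : Set₁ where
  field
    generator : ℚ
    divides   : ∀ i → ∃ λ z → f i ≡ ι z * generator
    generated : ∀ {P} → Submodule P → (∀ i → P (f i)) → P generator

content : ∀ {n} (f : Fin n → ℚ) → Content f
-- The empty family spans the zero subgroup.
content {zero}  f = record { generator = 0ℚ ; divides = λ () ; generated = λ S _ → Submodule.zero∈ S }
content {suc n} f = record
  { generator = q
  ; divides   = λ
    { zero    → s , left
    ; (suc i) → let z , eq = divides i in
        z ℤ.* t , trans eq (trans (cong (ι z *_) right)
          (trans (sym (*-assoc (ι z) (ι t) q)) (cong (_* q) (sym (ι-* z t))))) }
  ; generated = λ {P} S Pf → subst P (sym combine)
      (Submodule.plus S (Submodule.scale S u (Pf zero)) (Submodule.scale S v (generated S (Pf ∘ suc))))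
  }
  where
  open Content (content (f ∘ suc))
  open Gcdℚ (gcdℚ (f zero) generator)

matrix-content : ∀ {m n} (A : Fin m → Fin n → ℚ) → Content (λ (ij : Fin m × Fin n) → A (proj₁ ij) (proj₂ ij))
matrix-content A = record
  { generator = Content.generator all
  ; divides   = λ { (i , j) →
      let z , eq = Content.divides (row i) j
          w , eq′ = Content.divides all i
      in z ℤ.* w , trans eq (trans (cong (ι z *_) eq′)
           (trans (sym (*-assoc (ι z) (ι w) (Content.generator all))) (cong (_* Content.generator all) (sym (ι-* z w))))) }
  ; generated = λ S PA → Content.generated all S (λ i → Content.generated (row i) S (λ j → PA (i , j)))
  }
  where
  row : ∀ i → Content (A i)
  row i = content (A i)
  all : Content (λ i → Content.generator (row i))
  all = content (λ i → Content.generator (row i))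

-- The order spanned by Γ₀(N)

-- The condition of the order is split by position, so that each position gives a submodule of the
-- rationals.
Entry : ∀ {k} → ℕ → (a b : Fin (suc k)) → ℚ → Set
Entry {k} N a b x = IsInt x × (a ≡ fromℕ k → b ≢ fromℕ k → IsMultiple N x)

InOrder : ∀ {k} → ℕ → Mat ℚ (suc k) → Set
InOrder N g = ∀ a b → Entry N a b (g a b)

entry-submodule : ∀ {k} N (a b : Fin (suc k)) → Submodule (Entry N a b)
entry-submodule N a b = record
  { zero∈ = I.zero∈ , λ _ _ → M.zero∈
  ; plus  = λ { (ix , mx) (iy , my) → I.plus ix iy , λ a≡ b≢ → M.plus (mx a≡ b≢) (my a≡ b≢) }
  ; scale = λ { z (ix , mx) → I.scale z ix , λ a≡ b≢ → M.scale z (mx a≡ b≢) }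
  }
  where
  module I = Submodule int-submodule
  module M = Submodule (multiple-submodule N)

-- In the last row and off the last column, one factor is always a multiple of `N`: the second if
-- the middle index is the last one, otherwise the first.
entry-* : ∀ {k N} {a b c : Fin (suc k)} {x y} → Entry N a b x → Entry N b c y → Entry N a c (x * y)
entry-* {k} {b = b} (ix , mx) (iy , my) = int-* ix iy , multiple
  where
  multiple : _ → _ → _
  multiple a≡ c≢ with b ≟ fromℕ k
  ... | yes b≡ = multiple-*ˡ ix (my b≡ c≢)
  ... | no b≢  = multiple-*ʳ (mx a≡ b≢) iy

order-⊗ : ∀ {k N} {g h : Mat ℚ (suc k)} → InOrder N g → InOrder N h → InOrder N (g ⊗ h)
order-⊗ {N = N} og oh a b = Submodule.sum (entry-submodule N a b) (λ l → entry-* (og a l) (oh l b))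

idMat-entry : ∀ {k} N (a b : Fin (suc k)) → Entry N a b (idMat a b)
idMat-entry N a b = idMat-int a b , λ { refl b≢ → subst (IsMultiple N) (sym (idMat-off (b≢ ∘ sym)))
  (Submodule.zero∈ (multiple-submodule N)) }

-- Together with `⇒∈Γ₀` this identifies the group with the determinant 1 elements of the order, so
-- that later arguments can work entry by entry.
∈Γ₀⇒ : ∀ {k N} {g : Mat ℚ (suc k)} → g ∈Γ₀ N → det g ≡ 1ℚ × InOrder N g
∈Γ₀⇒ {k} {N} {g} (γ , (det≡1 , last-row) , g≈γ) = trans (det-cong g≈γ) det≡1 , entry
  where
  entry : InOrder N g
  entry a b = (γ a b , g≈γ a b) , λ { refl b≢ →
    let Signed.divides z eq = Signed.∣ᵤ⇒∣ {+ N} {γ (fromℕ k) b} (last-row b b≢) in z , trans (g≈γ a b) (cong ι eq) }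

⇒∈Γ₀ : ∀ {k N} {g : Mat ℚ (suc k)} → det g ≡ 1ℚ → InOrder N g → g ∈Γ₀ N
⇒∈Γ₀ {k} {N} {g} det≡1 order = γ , (trans (det-cong (≈-sym g≈γ)) det≡1 , last-row) , g≈γ
  where
  γ : Mat ℤ (suc k)
  γ a b = proj₁ (proj₁ (order a b))
  g≈γ : g ≈ₘ toℚMat γ
  g≈γ a b = proj₂ (proj₁ (order a b))
  last-row : ∀ j → j ≢ fromℕ k → + N Unsigned.∣ γ (fromℕ k) j
  last-row j j≢ with proj₂ (order (fromℕ k) j) refl j≢
  ... | z , eq = Signed.∣⇒∣ᵤ {+ N} (Signed.divides z
    (ι-injective {γ (fromℕ k) j} {z ℤ.* + N} (trans (sym (g≈γ (fromℕ k) j)) eq)))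

Γ₀-resp-≈ : ∀ {k N} {g g′ : Mat ℚ (suc k)} → g ≈ₘ g′ → g ∈Γ₀ N → g′ ∈Γ₀ N
Γ₀-resp-≈ g≈g′ (γ , γ∈ , g≈γ) = γ , γ∈ , ≈-trans (≈-sym g≈g′) g≈γ

Γ₀-⊗ : ∀ {k N} {g g′ : Mat ℚ (suc k)} → g ∈Γ₀ N → g′ ∈Γ₀ N → (g ⊗ g′) ∈Γ₀ N
Γ₀-⊗ {g = g} {g′} g∈ g′∈ with ∈Γ₀⇒ g∈ | ∈Γ₀⇒ g′∈
... | det-g , og | det-g′ , og′ = ⇒∈Γ₀ (trans (det-⊗ g g′) (cong₂ _*_ det-g det-g′)) (order-⊗ og og′)

det-inverse : ∀ {n} {g h : Mat ℚ n} → h ⊗ g ≈ₘ idMat → det h * det g ≡ 1ℚ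
det-inverse {n} {g} {h} hg≈1 = trans (sym (det-⊗ h g)) (trans (det-cong hg≈1) (det-id {n}))

-- By `cramer` and `det g` = 1, each entry of `h` is the determinant of an integral matrix. The last
-- row is then found from row `n` of `g ⊗ h` modulo `N`.
Γ₀-inverse : ∀ {k N} {g h : Mat ℚ (suc k)} → IsInverse g h → g ∈Γ₀ N → h ∈Γ₀ N
Γ₀-inverse {k} {N} {g} {h} (hg≈1 , gh≈1) g∈ = ⇒∈Γ₀ det-h (λ a b → int-h a b , λ { refl b≢ → last-row b b≢ })
  where
  n : Fin (suc k)
  n = fromℕ k
  det-g : det g ≡ 1ℚ
  det-g = proj₁ (∈Γ₀⇒ g∈)
  og : InOrder N g
  og = proj₂ (∈Γ₀⇒ g∈)
  det-h : det h ≡ 1ℚ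
  det-h = trans (sym (*-identityʳ (det h))) (trans (cong (det h *_) (sym det-g)) (det-inverse {g = g} {h} hg≈1))
  int-h : ∀ a b → IsInt (h a b)
  int-h a b = subst IsInt
    (trans (sym (cramer {A = h} {g} hg≈1 a b)) (trans (cong (h a b *_) det-g) (*-identityʳ (h a b))))
    (det-int int-C)
    where
    int-C : ∀ i j → IsInt (updateAt g b (const (idMat a)) i j)
    int-C i j with i ≟ b
    ... | yes refl = subst IsInt (cong (λ r → r j) (sym (updateAt-updates i g))) (idMat-int a j)
    ... | no i≢b   = subst IsInt (cong (λ r → r j) (sym (updateAt-minimal i b g i≢b))) (proj₁ (og i j))
  module M = Submodule (multiple-submodule N)
  -- Modulo `N`, only the summand at `n` survives in row `n` of `g ⊗ h`.
  tail-multiple : ∀ b → IsMultiple N (idMat n b + - (g n n * h n b))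
  tail-multiple b = subst (IsMultiple N) (cong (_+ - (g n n * h n b)) (gh≈1 n b))
    (M.sum-except n {λ l → g n l * h l b} (λ l l≢n → multiple-*ʳ (proj₂ (og n l) refl l≢n) (int-h l b)))
  -- Modulo N, g n n inverts h n n and annihilates h n b.
  last-row : ∀ b → b ≢ n → IsMultiple N (h n b)
  last-row b b≢n = subst (IsMultiple N) identity
    (M.minus (multiple-*ˡ (int-h n b) (tail-multiple n)) (multiple-*ˡ (int-h n n) (tail-multiple b)))
    where
    identity : h n b * (idMat n n + - (g n n * h n n)) + - (h n n * (idMat n b + - (g n n * h n b))) ≡ h n b
    identity = trans
      (cong₂ (λ x y → h n b * (x + - (g n n * h n n)) + - (h n n * (y + - (g n n * h n b))))
        (idMat-diag n) (idMat-off (b≢n ∘ sym)))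
      (solve 3 (λ x y g → x :* (con 1ℚ :- g :* y) :- y :* (con 0ℚ :- g :* x) := x) refl (h n b) (h n n) (g n n))

-- Transvections

transvection : ∀ {n} (i j : Fin n) → Mat ℚ n
transvection i j a b = idMat a b + idMat a i * idMat j b

-- Row `i` is a sum of two unit vectors; splitting it gives the identity and a matrix `E` with rows
-- `i` and `j` equal. Since `i` is not the last index, the last row stays that of the identity.
transvection-∈Γ₀ : ∀ {k} N {i j : Fin (suc k)} → i ≢ j → i ≢ fromℕ k → transvection i j ∈Γ₀ N
transvection-∈Γ₀ {k} N {i} {j} i≢j i≢n = ⇒∈Γ₀ det≡1 order
  where
  order : InOrder N (transvection i j)
  order a b = Submodule.plus (entry-submodule N a b) (idMat-entry N a b)
    ( int-* (idMat-int a i) (idMat-int j b)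
    , λ { refl b≢n → multiple-*ʳ (proj₂ (idMat-entry N a i) refl i≢n) (idMat-int j b) })
  E : Mat ℚ (suc k)
  E = updateAt idMat i (const (idMat j))
  E-at : E i ≗ idMat j
  E-at b = cong (λ r → r b) (updateAt-updates i idMat)
  E-off : ∀ l → l ≢ i → E l ≗ idMat l
  E-off l l≢i b = cong (λ r → r b) (updateAt-minimal l i idMat l≢i)
  unchanged : ∀ l → l ≢ i → idMat l ≗ transvection i j l
  unchanged l l≢i b = sym (trans
    (cong (λ x → idMat l b + x * idMat j b) (idMat-off l≢i))
    (solve 2 (λ x y → x :+ con 0ℚ :* y := x) refl (idMat l b) (idMat j b)))
  det≡1 : det (transvection i j) ≡ 1ℚ
  det≡1 = begin
    det (transvection i j)
      ≡⟨ det-linear i 1ℚ 1ℚ unchanged (λ l l≢i b → trans (E-off l l≢i b) (unchanged l l≢i b))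
           (λ b → trans (cong (λ x → idMat i b + x * idMat j b) (idMat-diag i))
             (cong₂ _+_ (sym (*-identityˡ (idMat i b))) (cong (1ℚ *_) (sym (E-at b))))) ⟩
    1ℚ * det (idMat {suc k}) + 1ℚ * det E
      ≡⟨ cong₂ (λ x y → 1ℚ * x + 1ℚ * y) (det-id {suc k})
           (det-repeat i j E i≢j (λ b → trans (E-at b) (sym (E-off j (i≢j ∘ sym) b)))) ⟩
    1ℚ ∎

-- The identity part of the transvection conjugates to the identity, and the matrix unit to column
-- `i` of `h` times row `j` of `g`.
conjugate-transvection : ∀ {n} {g h : Mat ℚ n} → h ⊗ g ≈ₘ idMat → ∀ i j a b →
  ((h ⊗ transvection i j) ⊗ g) a b + - idMat a b ≡ h a i * g j b
conjugate-transvection {n} {g} {h} hg≈1 i j a b = begin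
  Σℚ n (λ l → (h ⊗ transvection i j) a l * g l b) + - idMat a b
    ≡⟨ cong (_+ - idMat a b) (trans (Σ-cong (λ l → trans (cong (_* g l b) (left l))
         (solve 4 (λ x y e z → (x :+ y :* e) :* z := x :* z :+ y :* (e :* z)) refl (h a l) (h a i) (idMat j l) (g l b))))
         (Σ-+ (λ l → h a l * g l b) (λ l → h a i * (idMat j l * g l b)))) ⟩
  Σℚ n (λ l → h a l * g l b) + Σℚ n (λ l → h a i * (idMat j l * g l b)) + - idMat a b
    ≡⟨ cong₂ (λ x y → x + y + - idMat a b) (hg≈1 a b)
         (trans (sym (Σ-distribˡ (h a i) (λ l → idMat j l * g l b))) (cong (h a i *_) (Σ-idˡ j (λ l → g l b)))) ⟩
  idMat a b + h a i * g j b + - idMat a b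
    ≡⟨ solve 2 (λ e x → e :+ x :- e := x) refl (idMat a b) (h a i * g j b) ⟩
  h a i * g j b ∎
  where
  left : ∀ l → (h ⊗ transvection i j) a l ≡ h a l + h a i * idMat j l
  left l = begin
    Σℚ n (λ m → h a m * (idMat m l + idMat m i * idMat j l))
      ≡⟨ Σ-cong (λ m → solve 4 (λ x e f y → x :* (e :+ f :* y) := x :* e :+ x :* f :* y)
           refl (h a m) (idMat m l) (idMat m i) (idMat j l)) ⟩
    Σℚ n (λ m → h a m * idMat m l + h a m * idMat m i * idMat j l)
      ≡⟨ Σ-+ (λ m → h a m * idMat m l) (λ m → h a m * idMat m i * idMat j l) ⟩
    Σℚ n (λ m → h a m * idMat m l) + Σℚ n (λ m → h a m * idMat m i * idMat j l)
      ≡⟨ cong₂ _+_ (Σ-idʳ l (h a)) (trans (sym (Σ-distribʳ (idMat j l) (λ m → h a m * idMat m i)))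
           (cong (_* idMat j l) (Σ-idʳ i (h a)))) ⟩
    h a l + h a i * idMat j l ∎

-- The normaliser

-- One inclusion of the normalising condition, kept apart so that `g` and `h` can exchange roles.
Conjugates : ∀ {k} → ℕ → (g h : Mat ℚ (suc k)) → Set
Conjugates N g h = ∀ γ → γ ∈Γ₀ N → ((h ⊗ γ) ⊗ g) ∈Γ₀ N

cancelˡ : ∀ {n} (g h A : Mat ℚ n) → g ⊗ h ≈ₘ idMat → g ⊗ (h ⊗ A) ≈ₘ A
cancelˡ g h A gh≈1 i j = begin
  (g ⊗ (h ⊗ A)) i j    ≡⟨ sym (⊗-assoc g h A i j) ⟩
  ((g ⊗ h) ⊗ A) i j    ≡⟨ ⊗-cong {A = g ⊗ h} {idMat} {A} gh≈1 (λ _ _ → refl) i j ⟩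
  (idMat ⊗ A) i j      ≡⟨ ⊗-identityˡ A i j ⟩
  A i j                ∎

cancelʳ : ∀ {n} (g h A : Mat ℚ n) → g ⊗ h ≈ₘ idMat → (A ⊗ g) ⊗ h ≈ₘ A
cancelʳ g h A gh≈1 i j = begin
  ((A ⊗ g) ⊗ h) i j    ≡⟨ ⊗-assoc A g h i j ⟩
  (A ⊗ (g ⊗ h)) i j    ≡⟨ ⊗-cong {A = A} {A} {g ⊗ h} {idMat} (λ _ _ → refl) gh≈1 i j ⟩
  (A ⊗ idMat) i j      ≡⟨ ⊗-identityʳ A i j ⟩
  A i j                ∎

conjugate-back : ∀ {n} (g h γ : Mat ℚ n) → g ⊗ h ≈ₘ idMat → (g ⊗ ((h ⊗ γ) ⊗ g)) ⊗ h ≈ₘ γ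
conjugate-back g h γ gh≈1 i j = begin
  ((g ⊗ ((h ⊗ γ) ⊗ g)) ⊗ h) i j
    ≡⟨ ⊗-cong {A = g ⊗ ((h ⊗ γ) ⊗ g)} {γ ⊗ g} {h} inner (λ _ _ → refl) i j ⟩
  ((γ ⊗ g) ⊗ h) i j
    ≡⟨ cancelʳ g h γ gh≈1 i j ⟩
  γ i j ∎
  where
  inner : g ⊗ ((h ⊗ γ) ⊗ g) ≈ₘ γ ⊗ g
  inner i j = begin
    (g ⊗ ((h ⊗ γ) ⊗ g)) i j  ≡⟨ ⊗-cong {A = g} {g} {(h ⊗ γ) ⊗ g} {h ⊗ (γ ⊗ g)} (λ _ _ → refl) (⊗-assoc h γ g) i j ⟩
    (g ⊗ (h ⊗ (γ ⊗ g))) i j  ≡⟨ cancelˡ g h (γ ⊗ g) gh≈1 i j ⟩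
    (γ ⊗ g) i j              ∎

-- Surjectivity provides `γ` with conjugate `δ`; conjugating back shows that the conjugate of `δ` by
-- the inverse is `γ`.
normalises-inverse : ∀ {k N} {g h : Mat ℚ (suc k)} → IsInverse g h → Normalises N g h → Conjugates N h g
normalises-inverse {g = g} {h} (_ , gh≈1) (_ , onto) δ δ∈ with onto δ δ∈
... | γ , γ∈ , hγg≈δ = Γ₀-resp-≈ back γ∈
  where
  back : γ ≈ₘ (g ⊗ δ) ⊗ h
  back i j = begin
    γ i j                            ≡⟨ sym (conjugate-back g h γ gh≈1 i j) ⟩
    ((g ⊗ ((h ⊗ γ) ⊗ g)) ⊗ h) i j    ≡⟨ ⊗-cong {A = g ⊗ ((h ⊗ γ) ⊗ g)} {g ⊗ δ} {h}
                                          (⊗-cong {A = g} {g} {(h ⊗ γ) ⊗ g} {δ} (λ _ _ → refl) hγg≈δ) (λ _ _ → refl) i j ⟩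
    ((g ⊗ δ) ⊗ h) i j                ∎

-- h a i * g j b is entry (a, b) of the conjugate of the matrix unit E i j.  For i ≢ j it is read off a
-- transvection; E i i = E i j E j i for some j ≢ i, n because n > 2; E n n is 1 minus the other E i i.
conjugate-unit : ∀ {k N} {g h : Mat ℚ (suc (suc (suc k)))} → h ⊗ g ≈ₘ idMat → g ⊗ h ≈ₘ idMat →
                 Conjugates N g h →
                 ∀ i j → i ≢ fromℕ (suc (suc k)) ⊎ i ≡ j → ∀ a b → Entry N a b (h a i * g j b)
conjugate-unit {k} {N} {g} {h} hg≈1 gh≈1 conj = unit
  where
  n : Fin (suc (suc (suc k)))
  n = fromℕ (suc (suc k))
  off-diagonal : ∀ {i j} → i ≢ j → i ≢ n → ∀ a b → Entry N a b (h a i * g j b)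
  off-diagonal {i} {j} i≢j i≢n a b = subst (Entry N a b) (conjugate-transvection {g = g} {h} hg≈1 i j a b)
    (Submodule.minus (entry-submodule N a b)
      (proj₂ (∈Γ₀⇒ (conj _ (transvection-∈Γ₀ N i≢j i≢n))) a b) (idMat-entry N a b))
  other : ∀ i → ∃ λ j → i ≢ j × j ≢ n
  other zero    = suc zero , (λ ()) , λ ()
  other (suc i) = zero , (λ ()) , λ ()
  diagonal : ∀ i → i ≢ n → ∀ a b → Entry N a b (h a i * g i b)
  diagonal i i≢n a b with other i
  ... | j , i≢j , j≢n = subst (Entry N a b) factor
    (order-⊗ {g = λ a c → h a i * g j c} {λ c b → h c j * g i b}
      (off-diagonal i≢j i≢n) (off-diagonal (i≢j ∘ sym) j≢n) a b)
    where
    factor : Σℚ _ (λ c → (h a i * g j c) * (h c j * g i b)) ≡ h a i * g i b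
    factor = begin
      Σℚ _ (λ c → (h a i * g j c) * (h c j * g i b))
        ≡⟨ Σ-cong (λ c → solve 4 (λ x y z w → (x :* y) :* (z :* w) := x :* w :* (y :* z))
             refl (h a i) (g j c) (h c j) (g i b)) ⟩
      Σℚ _ (λ c → h a i * g i b * (g j c * h c j))
        ≡⟨ sym (Σ-distribˡ (h a i * g i b) (λ c → g j c * h c j)) ⟩
      h a i * g i b * Σℚ _ (λ c → g j c * h c j)
        ≡⟨ cong (h a i * g i b *_) (trans (gh≈1 j j) (idMat-diag j)) ⟩
      h a i * g i b * 1ℚ
        ≡⟨ *-identityʳ (h a i * g i b) ⟩
      h a i * g i b ∎
  last : ∀ a b → Entry N a b (h a n * g n b)
  last a b = subst (Entry N a b)
    (trans (cong (λ x → idMat a b + - (x + - (h a n * g n b))) (hg≈1 a b))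
      (solve 2 (λ e x → e :- (e :- x) := x) refl (idMat a b) (h a n * g n b)))
    (Submodule.minus (entry-submodule N a b) (idMat-entry N a b)
      (Submodule.sum-except (entry-submodule N a b) n {λ i → h a i * g i b} (λ i i≢n → diagonal i i≢n a b)))
  unit : ∀ i j → i ≢ n ⊎ i ≡ j → ∀ a b → Entry N a b (h a i * g j b)
  unit i j hyp with i ≟ n | i ≟ j
  unit i j hyp          | no i≢n   | yes refl = diagonal i i≢n
  unit i j hyp          | no i≢n   | no i≢j   = off-diagonal i≢j i≢n
  unit i j hyp          | yes refl | yes refl = last
  unit i j (inj₁ i≢n)   | yes i≡n  | no i≢j   = contradiction i≡n i≢n
  unit i j (inj₂ i≡j)   | yes _    | no i≢j   = contradiction i≡j i≢j

positive-unit : ∀ x y → y ℤ.* x ≡ + 1 → x ≢ ℤ.- + 1 → x ≡ + 1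
positive-unit x y yx≡1 x≢-1 = cases x ∣x∣≡1 x≢-1
  where
  ∣x∣≡1 : ∣ x ∣ ≡ 1
  ∣x∣≡1 = ℕ.m*n≡1⇒n≡1 (∣ y ∣) (∣ x ∣) (trans (sym (ℤ.abs-* y x)) (cong ∣_∣ yx≡1))
  cases : ∀ x → ∣ x ∣ ≡ 1 → x ≢ ℤ.- + 1 → x ≡ + 1
  cases (+ 1)    refl _    = refl
  cases -[1+ 0 ] refl x≢-1 = contradiction refl x≢-1

-- The determinants of `γ` and `η` are integers with product 1, so `det γ` is 1 or -1. Scaling by a
-- positive `q` preserves its sign, which rules out -1.
integral-inverse-det : ∀ {n} {γ η : Mat ℚ n} → η ⊗ γ ≈ₘ idMat →
                       (∀ i j → IsInt (η i j)) → (∀ i j → IsInt (γ i j)) →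
                       ∀ q → q > 0ℚ → det (q ·ₘ γ) > 0ℚ → det γ ≡ 1ℚ
integral-inverse-det {γ = γ} {η} ηγ≈1 int-η int-γ q q>0 det>0
  with det-scale q q>0 | det-int int-η | det-int int-γ
... | p , p>0 , scales | y , det-η≡y | x , det-γ≡x = trans det-γ≡x (cong ι (positive-unit x y yx≡1 x≢-1))
  where
  yx≡1 : y ℤ.* x ≡ + 1
  yx≡1 = ι-injective {y ℤ.* x} {+ 1} (trans (ι-* y x)
    (trans (cong₂ _*_ (sym det-η≡y) (sym det-γ≡x)) (det-inverse {g = γ} {η} ηγ≈1)))
  x≢-1 : x ≢ ℤ.- + 1
  x≢-1 x≡-1 = <-asym (neg-antimono-< p>0) (subst (_> 0ℚ) det≡-p det>0)
    where
    det≡-p : det (q ·ₘ γ) ≡ - p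
    det≡-p = trans (scales γ)
      (trans (cong (p *_) (trans det-γ≡x (cong ι x≡-1)))
             (solve 1 (λ p → p :* :- con 1ℚ := :- p) refl p))

module _ {k N : ℕ} {g h : Mat ℚ (suc (suc (suc k)))} (inverse : IsInverse g h)
         (conj : Conjugates N g h) (conj⁻¹ : Conjugates N h g) where

  private
    n : Fin (suc (suc (suc k)))
    n = fromℕ (suc (suc k))

    unit : ∀ i j → i ≢ n ⊎ i ≡ j → ∀ a b → Entry N a b (h a i * g j b)
    unit = conjugate-unit {g = g} {h} (proj₁ inverse) (proj₂ inverse) conj

    unit⁻¹ : ∀ i j → i ≢ n ⊎ i ≡ j → ∀ a b → Entry N a b (g a i * h j b)
    unit⁻¹ = conjugate-unit {g = h} {g} (proj₂ inverse) (proj₁ inverse) conj⁻¹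

  -- Only the products g j n * h a n with j, a ≢ n are not covered by unit and unit⁻¹.  Call one x and put
  -- u i l = g i n * h n l.  For i, l ≢ n, g h = 1 makes x (δ i l − u i l) integral, and
  -- u 0 0 u 1 1 = u 0 1 u 1 0 then expresses x through integral numbers; this needs two indices besides n.
  corner-int : ∀ j a → j ≢ n → a ≢ n → IsInt (g j n * h a n)
  corner-int j a j≢n a≢n = subst IsInt identity
    (I.minus (I.plus (defect z z z≢n) (int-* (u-int {z} z≢n) (defect o o o≢n)))
             (int-* (u-int {o} z≢n) (defect z o o≢n)))
    where
    module I = Submodule int-submodule
    x : ℚ
    x = g j n * h a n
    u : (i l : Fin (suc (suc (suc k)))) → ℚ
    u i l = g i n * h n l
    z o : Fin (suc (suc (suc k)))
    z = zero
    o = suc zero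
    z≢n : z ≢ n
    z≢n ()
    o≢n : o ≢ n
    o≢n ()
    u-int : ∀ {i l} → l ≢ n → IsInt (u i l)
    u-int {i} {l} l≢n = subst IsInt (*-comm (h n l) (g i n)) (proj₁ (unit l i (inj₁ l≢n) n n))
    -- Multiply the sum for entry (i, l) of `g ⊗ h` by `x`. Each term with `b` other than `n`
    -- regroups as `h b l * g j n` times `g i b * h a n`, two integral products.
    defect : ∀ i l → l ≢ n → IsInt (x * (idMat i l + - u i l))
    defect i l l≢n = subst (λ y → IsInt (x * (y + - u i l))) (proj₂ inverse i l)
      (Submodule.sum-except (preimage-submodule x int-submodule) n {λ b → g i b * h b l} (λ b b≢n →
        subst IsInt
          (solve 4 (λ p q r s → (p :* q) :* (r :* s) := (q :* s) :* (r :* p))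
             refl (h b l) (g j n) (g i b) (h a n))
          (int-* (proj₁ (unit l j (inj₁ l≢n) b n)) (proj₁ (unit⁻¹ b a (inj₁ b≢n) i n)))))
    identity : x * (1ℚ + - u z z) + u z z * (x * (1ℚ + - u o o)) + - (u o z * (x * (0ℚ + - u z o))) ≡ x
    identity = solve 5 (λ x g₀ h₀ g₁ h₁ →
      x :* (con 1ℚ :- g₀ :* h₀) :+ (g₀ :* h₀) :* (x :* (con 1ℚ :- g₁ :* h₁)) :- (g₁ :* h₀) :* (x :* (con 0ℚ :- g₀ :* h₁)) := x)
      refl x (g z n) (h n z) (g o n) (h n o)

  -- `unit` settles the cases `i` ≢ `n` and `i` ≡ `j`, and `unit⁻¹` the cases `b` ≢ `n` and `b` ≡
  -- `a`. What remains has `i` and `b` equal to `n` but `j` and `a` different from it.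
  product-int : ∀ j b a i → IsInt (g j b * h a i)
  product-int j b a i with i ≟ n | i ≟ j | b ≟ n | b ≟ a
  ... | no i≢n   | _        | _        | _        = subst IsInt (*-comm (h a i) (g j b)) (proj₁ (unit i j (inj₁ i≢n) a b))
  ... | _        | yes refl | _        | _        = subst IsInt (*-comm (h a i) (g j b)) (proj₁ (unit i j (inj₂ refl) a b))
  ... | _        | _        | no b≢n   | _        = proj₁ (unit⁻¹ b a (inj₁ b≢n) j i)
  ... | _        | _        | _        | yes refl = proj₁ (unit⁻¹ b a (inj₂ refl) j i)
  ... | yes refl | no i≢j   | yes refl | no b≢a   = corner-int j a (i≢j ∘ sym) (b≢a ∘ sym)


  private
    -- These products stand at position (n, 0) of a conjugated matrix unit, where the order demands
    -- multiples of `N`.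
    N-last-row : ∀ b → b ≢ n → ∀ c → IsMultiple N (g n b * h c zero)
    N-last-row b b≢n c with b ≟ c
    ... | yes refl = proj₂ (unit⁻¹ b b (inj₂ refl) n zero) refl (λ ())
    ... | no _     = proj₂ (unit⁻¹ b c (inj₁ b≢n) n zero) refl (λ ())

  conjugates-scaled : det g > 0ℚ → InScaledΓ₀ N g
  conjugates-scaled det>0 = result
    where
    open Content (matrix-content g)
    Γ : Mat ℤ (suc (suc (suc k)))
    Γ i j = proj₁ (divides (i , j))
    g≡Γq : ∀ i j → g i j ≡ ι (Γ i j) * generator
    g≡Γq i j = proj₂ (divides (i , j))
    -- The rationals with integral product with `h a i` form a submodule containing every entry of
    -- `g`, hence also its content.
    qh-int : ∀ a i → IsInt (h a i * generator)
    qh-int a i = generated (preimage-submodule (h a i) int-submodule)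
      (λ { (j , b) → subst IsInt (*-comm (g j b) (h a i)) (product-int j b a i) })
    -- Multiply by entry (0, 0) of `g ⊗ h`, which is 1. As `g` is `Γ` times the generator, `Γ n b`
    -- and `g zero c` can be traded for `Γ zero c` and `g n b`, which brings in the products of
    -- `N-last-row`.
    last-row : ∀ b → b ≢ n → IsMultiple N (ι (Γ n b))
    last-row b b≢n = subst (IsMultiple N) expansion
      (Submodule.sum (multiple-submodule N) (λ c → Submodule.scale (multiple-submodule N) (Γ zero c) (N-last-row b b≢n c)))
      where
      expansion : Σℚ _ (λ c → ι (Γ zero c) * (g n b * h c zero)) ≡ ι (Γ n b)
      expansion = begin
        Σℚ _ (λ c → ι (Γ zero c) * (g n b * h c zero))
          ≡⟨ Σ-cong (λ c → trans (cong (λ x → ι (Γ zero c) * (x * h c zero)) (g≡Γq n b))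
               (trans (solve 4 (λ y x q z → y :* (x :* q :* z) := x :* (y :* q :* z))
                         refl (ι (Γ zero c)) (ι (Γ n b)) generator (h c zero))
                      (cong (λ x → ι (Γ n b) * (x * h c zero)) (sym (g≡Γq zero c))))) ⟩
        Σℚ _ (λ c → ι (Γ n b) * (g zero c * h c zero))
          ≡⟨ sym (Σ-distribˡ (ι (Γ n b)) (λ c → g zero c * h c zero)) ⟩
        ι (Γ n b) * Σℚ _ (λ c → g zero c * h c zero)
          ≡⟨ cong (ι (Γ n b) *_) (proj₂ inverse zero zero) ⟩
        ι (Γ n b) * 1ℚ
          ≡⟨ *-identityʳ (ι (Γ n b)) ⟩
        ι (Γ n b) ∎
    -- The content is determined only up to sign; `e` is the sign that makes the scalar positive.
    scaled : ∀ (e : ℤ) → e ℤ.* e ≡ + 1 → ι e * generator > 0ℚ → InScaledΓ₀ N g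
    scaled e e²≡1 q>0 = q , q>0 , γ , ⇒∈Γ₀ det≡1 order , g≈qγ
      where
      q : ℚ
      q = ι e * generator
      γ : Mat ℚ (suc (suc (suc k)))
      γ i j = ι e * ι (Γ i j)
      g≈qγ : g ≈ₘ q ·ₘ γ
      g≈qγ i j = begin
        g i j                                    ≡⟨ g≡Γq i j ⟩
        ι (Γ i j) * generator                    ≡⟨ sym (*-identityˡ (ι (Γ i j) * generator)) ⟩
        1ℚ * (ι (Γ i j) * generator)             ≡⟨ cong (λ x → x * (ι (Γ i j) * generator)) (trans (cong ι (sym e²≡1)) (ι-* e e)) ⟩
        ι e * ι e * (ι (Γ i j) * generator)
          ≡⟨ solve 3 (λ e z q → e :* e :* (z :* q) := e :* q :* (e :* z)) refl (ι e) (ι (Γ i j)) generator ⟩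
        q * γ i j                                ∎
      order : InOrder N γ
      order a b = int-* (e , refl) (Γ a b , refl) , λ { refl b≢n → multiple-*ˡ (e , refl) (last-row b b≢n) }
      -- The inverse of `γ`, integral by `qh-int`, so the determinant of `γ` is a unit.
      η : Mat ℚ (suc (suc (suc k)))
      η i j = h i j * q
      int-η : ∀ i j → IsInt (η i j)
      int-η i j = subst IsInt (solve 3 (λ e h q → e :* (h :* q) := h :* (e :* q)) refl (ι e) (h i j) generator)
        (int-* (e , refl) (qh-int i j))
      ηγ≈1 : η ⊗ γ ≈ₘ idMat
      ηγ≈1 i j = trans (Σ-cong (λ l → trans (*-assoc (h i l) q (γ l j)) (cong (h i l *_) (sym (g≈qγ l j)))))
                       (proj₁ inverse i j)
      det≡1 : det γ ≡ 1ℚ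
      det≡1 = integral-inverse-det {γ = γ} {η} ηγ≈1 int-η (λ i j → proj₁ (order i j)) q q>0
        (subst (_> 0ℚ) (det-cong g≈qγ) det>0)
    -- A vanishing content would make `g` zero, against `h ⊗ g` being the identity.
    generator≢0 : generator ≢ 0ℚ
    generator≢0 q≡0 = contradiction 1≡0 (λ ())
      where
      1≡0 : 1ℚ ≡ 0ℚ
      1≡0 = trans (sym (proj₁ inverse zero zero)) (Σ-zero (λ l →
        trans (cong (h zero l *_) (trans (g≡Γq l zero) (trans (cong (ι (Γ l zero) *_) q≡0) (*-zeroʳ (ι (Γ l zero))))))
              (*-zeroʳ (h zero l))))
    result : InScaledΓ₀ N g
    result with <-cmp generator 0ℚ
    ... | tri< q<0 _ _ = scaled (ℤ.- + 1) refl
      (subst (_> 0ℚ) (solve 1 (λ q → :- q := :- con 1ℚ :* q) refl generator) (neg-antimono-< q<0))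
    ... | tri≈ _ q≡0 _ = contradiction q≡0 generator≢0
    ... | tri> _ _ q>0 = scaled (+ 1) refl (subst (_> 0ℚ) (sym (*-identityˡ generator)) q>0)

-- Positive multiples of elements of the group normalise it

module _ {k N : ℕ} {g h : Mat ℚ (suc k)} (inverse : IsInverse g h) where

  -- The scalar cancels in the conjugation: `g` acts as `γ` does, and the inverse `η` of `γ` lies in
  -- the group by `Γ₀-inverse`.
  scaled-normalises : InScaledΓ₀ N g → Normalises N g h
  scaled-normalises (q , _ , γ , γ∈ , g≈qγ) = into , onto
    where
    η : Mat ℚ (suc k)
    η i j = h i j * q
    h∙g : ∀ (A : Mat ℚ (suc k)) → (h ⊗ A) ⊗ g ≈ₘ (η ⊗ A) ⊗ γ
    h∙g A i j = Σ-cong (λ l → begin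
      (h ⊗ A) i l * g l j           ≡⟨ cong ((h ⊗ A) i l *_) (g≈qγ l j) ⟩
      (h ⊗ A) i l * (q * γ l j)     ≡⟨ sym (*-assoc ((h ⊗ A) i l) q (γ l j)) ⟩
      (h ⊗ A) i l * q * γ l j       ≡⟨ cong (_* γ l j) (trans (Σ-distribʳ q (λ m → h i m * A m l))
        (Σ-cong (λ m → solve 3 (λ x y q → x :* y :* q := x :* q :* y) refl (h i m) (A m l) q))) ⟩
      (η ⊗ A) i l * γ l j           ∎)
    ηγ≈1 : η ⊗ γ ≈ₘ idMat
    ηγ≈1 i j = trans (Σ-cong (λ l → trans (*-assoc (h i l) q (γ l j)) (cong (h i l *_) (sym (g≈qγ l j)))))
                     (proj₁ inverse i j)
    γη≈1 : γ ⊗ η ≈ₘ idMat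
    γη≈1 i j = trans (Σ-cong (λ l → trans
        (solve 3 (λ x y q → x :* (y :* q) := q :* x :* y) refl (γ i l) (h l j) q)
        (cong (_* h l j) (sym (g≈qγ i l)))))
      (proj₂ inverse i j)
    η∈ : η ∈Γ₀ N
    η∈ = Γ₀-inverse {g = γ} {η} (ηγ≈1 , γη≈1) γ∈
    into : ∀ A → A ∈Γ₀ N → ((h ⊗ A) ⊗ g) ∈Γ₀ N
    into A A∈ = Γ₀-resp-≈ (≈-sym (h∙g A)) (Γ₀-⊗ {g = η ⊗ A} {γ} (Γ₀-⊗ {g = η} {A} η∈ A∈) γ∈)
    onto : ∀ D → D ∈Γ₀ N → ∃ λ A → A ∈Γ₀ N × (h ⊗ A) ⊗ g ≈ₘ D
    -- The preimage of `D` is its conjugate by the inverse of `γ`.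
    onto D D∈ = (γ ⊗ D) ⊗ η , Γ₀-⊗ {g = γ ⊗ D} {η} (Γ₀-⊗ {g = γ} {D} γ∈ D∈) η∈ , back
      where
      back : (h ⊗ ((γ ⊗ D) ⊗ η)) ⊗ g ≈ₘ D
      back i j = trans (h∙g ((γ ⊗ D) ⊗ η) i j) (conjugate-back η γ D ηγ≈1 i j)

theorem4p1 : (k : ℕ) → 2 < suc k → (N : ℕ) → 1 ≤ N →
    (g h : Mat ℚ (suc k)) → IsInverse g h → det g > 0ℚ →
    (Normalises N g h → InScaledΓ₀ N g) × (InScaledΓ₀ N g → Normalises N g h)
-- Sizes 1 and 2 contradict the bound; the remaining sizes have two indices besides the last one.
theorem4p1 zero          (ℕ.s≤s ())
theorem4p1 (suc zero)    (ℕ.s≤s (ℕ.s≤s ()))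
theorem4p1 (suc (suc k)) _ N _ g h inverse det>0 =
  (λ normalises → conjugates-scaled {g = g} {h} inverse (proj₁ normalises)
    (normalises-inverse {g = g} {h} inverse normalises) det>0) ,
  scaled-normalises {g = g} {h} inverse
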